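{- Let $s\ge1$ and $q=2^s$. Up to isotopy, the presemifields $B(2,2s,s,l,t)$ with $l\neq 0$ coincide with the semifields $B_q(w)$. That is, every $B(2,2s,s,l,t)$ with $t$ legitimate and $l\in L^*\setminus(L^*)^{q-1}$ is isotopic to $B_q(w)$ for some $w\in L\setminus K$ with $\mathrm{tr}_{K|\mathbb{F}_2}(1/\tau(w))=0$, and conversely every such $B_q(w)$ is isotopic to some such $B(2,2s,s,l,t)$.
   Context: A (finite) presemifield is a finite additive abelian group with a multiplication that is distributive on both sides over addition and has no zero divisors; it is a semifield if it also has a multiplicative identity. Two presemifields $(F,+,*)$ and $(F,+,\circ)$ are isotopic if there are additive bijections $\alpha_1,\alpha_2,\beta$ with $\beta(\alpha_1(x)*\alpha_2(y))=x\circ y$ for all $x,y$. Let $q=2^s$, $K=\mathbb{F}_q\subset L=\mathbb{F}_{q^2}$, $\tau:L\to K$, $\tau(u)=u+u^q$, the trace, and $\mathrm{tr}_{K|\mathbb{F}_2}$ the absolute trace of $K$; $(L^*)^{q-1}=\{u^{q-1}:u\in L^*\}$. A quadruple $t=[p_1,p_2,p_3,p_4]\in L^4$ is legitimate (for $m=2s$, $\sigma=2^s=q$) if $p_1\neq0$ and $p_1X^{q+1}+p_2X^{q}+p_3X+p_4$ has no root in $L$. $B(2,2s,s,l,t)$ is the presemifield on $L\times L$ with multiplication $$(a,b)\circ(c,d)=(p_1ac^{q}+lp_1a^{q}c+p_2bc^{q}+lp_2a^{q}d+p_3ad^{q}+lp_3b^{q}c+p_4bd^{q}+lp_4b^{q}d,\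 ad+bc).$$ For $w\in L\setminus K$ with $\mathrm{tr}_{K|\mathbb{F}_2}(1/\tau(w))=0$, $B_q(w)$ is the semifield on $L\times L$ with multiplication $$(a,b)\star(c,d)=(ac+bd^q+wb^qd,\ a^qd+bc).$$ -}

module Defs where

open import Algebra.Bundles using (AbelianGroup; CommutativeRing)
open import Algebra.Core using (Op₂)
import Algebra.Construct.DirectProduct as DirectProduct
import Algebra.Definitions as AlgebraDefinitions
import Algebra.Properties.Semiring.Exp as SemiringExp
import Algebra.Properties.Semiring.Sum as SemiringSum
open import Algebra.Morphism.Structures using (IsGroupIsomorphism)
open import Data.Fin.Base using (Fin; toℕ)
open import Data.Nat.Base as ℕ using (ℕ; _∸_)
open import Data.Product.Base using (Σ; ∃-syntax; _×_; _,_; proj₁)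
open import Data.Vec.Base using (Vec; []; _∷_)
open import Function.Bundles using (Inverse)
open import Level using (Level; _⊔_)
open import Relation.Binary.Bundles using (Setoid)
import Relation.Binary.Construct.On as On
open import Relation.Binary.Definitions using (_Respects_)
import Relation.Binary.PropositionalEquality.Properties as ≡
open import Relation.Unary using (Pred; _∈_; _∉_)

private
  variable
    a c ℓ k : Level

HasOrder : Setoid a ℓ → ℕ → Set (a ⊔ ℓ)
HasOrder S n = Inverse S (≡.setoid (Fin n))

record IsField (R : CommutativeRing c ℓ) : Set (c ⊔ ℓ) where
  open CommutativeRing R
  open AlgebraDefinitions _≈_ using (Invertible)
  field
    1≉0        : 1# ≉ 0#
    invertible : ∀ {x} → x ≉ 0# → Invertible 1# _*_ x

record IsSubfield (R : CommutativeRing c ℓ)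
                  (K : Pred (CommutativeRing.Carrier R) k) : Set (c ⊔ ℓ ⊔ k) where
  open CommutativeRing R
  field
    resp      : K Respects _≈_
    0∈        : 0# ∈ K
    1∈        : 1# ∈ K
    +-closed  : ∀ {x y} → x ∈ K → y ∈ K → x + y ∈ K
    *-closed  : ∀ {x y} → x ∈ K → y ∈ K → x * y ∈ K
    -‿closed  : ∀ {x} → x ∈ K → - x ∈ K
    ⁻¹-closed : ∀ {x y} → x ∈ K → x * y ≈ 1# → y ∈ K

-- Membership proofs are ignored by the equality, so HasOrder counts elements.
subsetSetoid : (S : Setoid a ℓ) → Pred (Setoid.Carrier S) k → Setoid (a ⊔ k) ℓ
subsetSetoid S P = On.setoid {B = Σ (Setoid.Carrier S) P} S proj₁

-- Isotopy of two multiplications on the same additive group. As for the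
-- standard library's morphisms, the laws of the multiplications play no role.
module _ (G : AbelianGroup c ℓ) where
  open AbelianGroup G using (Carrier; _≈_; rawGroup)

  record Isotopic (_*_ _∘_ : Op₂ Carrier) : Set (c ⊔ ℓ) where
    field
      α₁ α₂ β          : Carrier → Carrier
      α₁-isIsomorphism : IsGroupIsomorphism rawGroup rawGroup α₁
      α₂-isIsomorphism : IsGroupIsomorphism rawGroup rawGroup α₂
      β-isIsomorphism  : IsGroupIsomorphism rawGroup rawGroup β
      isotopy          : ∀ x y → β (α₁ x * α₂ y) ≈ (x ∘ y)

-- L is to be a field of order q², with q = 2 ^ s.
module Presemifields (s : ℕ) (L : CommutativeRing c ℓ) where
  open CommutativeRing L
  open SemiringExp semiring using (_^_)
  open SemiringSum semiring using (sum)

  q : ℕ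
  q = 2 ℕ.^ s

  L×L : AbelianGroup c ℓ
  L×L = DirectProduct.abelianGroup +-abelianGroup +-abelianGroup

  -- u ∈ (L*)^(q-1)
  IsPower[q-1] : Pred Carrier (c ⊔ ℓ)
  IsPower[q-1] u = ∃[ v ] v ≉ 0# × v ^ (q ∸ 1) ≈ u

  Legitimate : Pred (Vec Carrier 4) (c ⊔ ℓ)
  Legitimate (p₁ ∷ p₂ ∷ p₃ ∷ p₄ ∷ []) =
    p₁ ≉ 0# ×
    (∀ x → p₁ * x ^ (q ℕ.+ 1) + p₂ * x ^ q + p₃ * x + p₄ ≉ 0#)

  -- The multiplication of B(2, 2s, s, l, t).
  B : Carrier → Vec Carrier 4 → Op₂ (Carrier × Carrier)
  B l (p₁ ∷ p₂ ∷ p₃ ∷ p₄ ∷ []) (a , b) (c , d) =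
    ( p₁ * a * c ^ q + l * p₁ * a ^ q * c
    + p₂ * b * c ^ q + l * p₂ * a ^ q * d
    + p₃ * a * d ^ q + l * p₃ * b ^ q * c
    + p₄ * b * d ^ q + l * p₄ * b ^ q * d
    , a * d + b * c )

  -- The multiplication of B_q(w).
  Bq : Carrier → Op₂ (Carrier × Carrier)
  Bq w (a , b) (c , d) =
    ( a * c + b * d ^ q + w * b ^ q * d
    , a ^ q * d + b * c )

  -- The trace L → K.
  τ : Carrier → Carrier
  τ u = u + u ^ q

  -- The absolute trace K → 𝔽₂, with K and 𝔽₂ inside L; meaningful on K only.
  tr : Carrier → Carrier
  tr x = sum {s} λ i → x ^ (2 ℕ.^ toℕ i)

  -- w ∈ L ∖ K and tr (1 / τ w) = 0, where v = 1 / τ w.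
  Admissible : Pred Carrier k → Pred Carrier (c ⊔ ℓ ⊔ k)
  Admissible K w = w ∉ K × (∃[ v ] τ w * v ≈ 1# × tr v ≈ 0#)

{-# OPTIONS --safe #-}
module Submission where

-- Write xᵠ for x^q and let F(u, v) = p₁acᵠ + p₂bcᵠ + p₃adᵠ + p₄bdᵠ for u = (a, b)
-- and v = (c, d).  Then the product of u and v in B(2, 2s, s, l, t) is
-- (F(u, v) + l F(v, u), det(u, v)), and t is legitimate exactly when F is
-- anisotropic.  An anisotropic F has an orthogonal basis; after scaling, it becomes
-- acᵠ + μbdᵠ with τ(μ) ≠ 0, and l becomes an element m ≠ 0, 1 of K.  Writing
-- m = (1 + x)/x with x in K, one may also scale μ so that (x² + x)τ(μ) = 1.  The map
-- z ↦ x²(zᵠ + mz) on the first component, together with a ↦ aᵠ on the left factor,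
-- then gives B_q(w) for w = μ + x²τ(μ), and 1/τ(w) = x² + x has trace 0.  Conversely,
-- a 1/τ(w) of trace 0 is x² + x for some x in K, and the steps can be reversed.

open import Defs
open import Algebra.Bundles using (AbelianGroup; CommutativeRing; RawRing)
open import Algebra.Core using (Op₂)
import Algebra.Morphism.Construct.Composition as Composition
open import Algebra.Morphism.Structures using (IsGroupIsomorphism)
import Algebra.Properties.CommutativeMonoid.Sum as Sum
import Algebra.Properties.CommutativeSemiring.Exp as CommutativeSemiringExp
import Algebra.Properties.Group as GroupProperties
import Algebra.Properties.Ring as RingProperties
import Algebra.Properties.Semiring.Exp as SemiringExp
import Algebra.Properties.Semiring.Sum as SemiringSum
import Algebra.Solver.Ring
open import Algebra.Solver.Ring.AlmostCommutativeRing
  using (fromCommutativeRing; _-Raw-AlmostCommutative⟶_)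
open import Data.Bool.Base using (Bool; true; false; _xor_; _∧_)
import Data.Bool.Properties as Bool
open import Data.Fin.Base as Fin using (Fin; toℕ; punchIn)
import Data.Fin.Properties as Fin
open import Data.Fin.Permutation using (Permutation′; permutation; _⟨$⟩ʳ_)
open import Data.Maybe.Base using (just; nothing)
open import Data.Nat.Base as ℕ using (ℕ; zero; suc)
import Data.Nat.Properties as ℕ
open import Data.Product.Base using (∃-syntax; ∃₂; _×_; _,_; proj₁; proj₂)
open import Data.Sum.Base using (_⊎_; inj₁; inj₂; [_,_]′)
open import Data.Unit.Base using (tt)
open import Data.Vec.Base using (Vec; []; _∷_)
open import Data.Vec.N-ary using (N-ary; Eq; curryⁿ; curryⁿ-cong)
open import Function.Base using (id; _∘_)
open import Function.Bundles using (Inverse)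
open import Function.Properties.Inverse using (Inverse⇒Injection)
open import Level using (_⊔_)
open import Relation.Binary.Definitions using (Decidable)
open import Relation.Binary.PropositionalEquality.Core as ≡ using (_≡_)
import Relation.Binary.Reflection as Reflection
open import Relation.Nullary.Decidable.Core using (Dec; yes; no)
open import Relation.Nullary.Decidable using (via-injection)
open import Relation.Nullary.Negation using (¬_; contradiction)
open import Relation.Unary using (Pred; U; _∈_)

-- The obstacle is the orthogonal basis. `F` is additive in both arguments but in general not
-- Hermitian, so F(u, v) = 0 does not give F(v, u) = 0, and completing one vector by Gram-Schmidt is
-- not enough. Both must vanish, because the product mixes F(u, v) with F(v, u). In suitable
-- coordinates the two conditions combine into one quadratic equation over L. Solving it needs two
-- facts about fields of even order: square roots exist, and x² + x = c has a solution in L for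
-- every c in K.
--
-- The hypothesis on l enters through a norm. If l = ζ², then m is the norm of ζ and m² is that of
-- l. By Hilbert 90, l is a (q-1)-th power exactly when its norm is 1, that is, when m = 1.
--
-- Apart from the last step, x ∈ K is expressed by the equation xᵠ = x, and an element and its
-- conjugate are independent variables in every polynomial identity.

-- Cancellation and Fermat's little theorem in finite fields

module FieldProperties {c ℓ} (L : CommutativeRing c ℓ) (isField : IsField L) where
  open CommutativeRing L
  open IsField isField
  open SemiringExp semiring using (_^_; ^-congˡ; ^-congʳ; ^-assocʳ)
  open import Relation.Binary.Reasoning.Setoid setoid

  abstract
    inverse : ∀ {x} → x ≉ 0# → ∃[ y ] x * y ≈ 1#
    inverse x≉0 = let y , _ , xy≈1 = invertible x≉0 in y , xy≈1

  *-cancelˡ-≉0 : ∀ {x y z} → x ≉ 0# → x * y ≈ x * z → y ≈ z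
  *-cancelˡ-≉0 {x} {y} {z} x≉0 xy≈xz with i , ix≈1 , _ ← invertible x≉0 = begin
    y            ≈⟨ *-identityˡ y ⟨
    1# * y       ≈⟨ *-congʳ ix≈1 ⟨
    (i * x) * y  ≈⟨ *-assoc i x y ⟩
    i * (x * y)  ≈⟨ *-congˡ xy≈xz ⟩
    i * (x * z)  ≈⟨ *-assoc i x z ⟨
    (i * x) * z  ≈⟨ *-congʳ ix≈1 ⟩
    1# * z       ≈⟨ *-identityˡ z ⟩
    z            ∎

  *-≉0 : ∀ {x y} → x ≉ 0# → y ≉ 0# → x * y ≉ 0#
  *-≉0 x≉0 y≉0 xy≈0 = y≉0 (*-cancelˡ-≉0 x≉0 (trans xy≈0 (sym (zeroʳ _))))

  inverse-≉0 : ∀ {x y} → x * y ≈ 1# → y ≉ 0#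
  inverse-≉0 xy≈1 y≈0 = 1≉0 (trans (sym xy≈1) (trans (*-congˡ y≈0) (zeroʳ _)))

  1^n≈1 : ∀ n → 1# ^ n ≈ 1#
  1^n≈1 zero    = refl
  1^n≈1 (suc n) = trans (*-identityˡ _) (1^n≈1 n)

  module _ {k} {K : Pred Carrier k} (isSubfield : IsSubfield L K)
           {n : ℕ} (order : HasOrder (subsetSetoid setoid K) n) where
    open IsSubfield isSubfield
    open Inverse order using (to; from; to-cong; from-cong; inverseˡ; inverseʳ; strictlyInverseˡ; strictlyInverseʳ)

    private
      module Π = Sum *-commutativeMonoid

      el : Fin n → Carrier
      el i = proj₁ (from i)

      el-to : ∀ {x} (x∈ : x ∈ K) → el (to (x , x∈)) ≈ x
      el-to x∈ = strictlyInverseʳ (_ , x∈)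

      to-≡ : ∀ {x} (x∈ : x ∈ K) {i} → x ≈ el i → to (x , x∈) ≡ i
      to-≡ x∈ {i} x≈ = ≡.trans (to-cong x≈) (strictlyInverseˡ i)

      0? : ∀ i → Dec (el i ≈ 0#)
      0? i with i Fin.≟ to (0# , 0∈)
      ... | yes ≡.refl = yes (el-to 0∈)
      ... | no i≢      = no λ i≈0 → i≢ (≡.sym (to-≡ 0∈ (sym i≈0)))

      -- Multiplication by x permutes K.  In the product of the elements of K with 0
      -- replaced by 1, it leaves one factor fixed, so corr supplies the missing x.
      unit : ∀ {x} → Dec (x ≈ 0#) → Carrier
      unit     (yes _) = 1#
      unit {x} (no  _) = x

      unit-≉0 : ∀ {x} (x? : Dec (x ≈ 0#)) → unit x? ≉ 0#
      unit-≉0 (yes _)   = 1≉0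
      unit-≉0 (no x≉0) = x≉0

      Π-≉0 : ∀ {m} (f : Fin m → Carrier) → (∀ i → f i ≉ 0#) → Π.sum f ≉ 0#
      Π-≉0 {zero}  f f≉0 = 1≉0
      Π-≉0 {suc m} f f≉0 = *-≉0 (f≉0 Fin.zero) (Π-≉0 (f ∘ Fin.suc) (f≉0 ∘ Fin.suc))

    module _ {x} (x∈ : x ∈ K) (x≉0 : x ≉ 0#) where
      private
        y : Carrier
        y = proj₁ (inverse x≉0)

        xy≈1 : x * y ≈ 1#
        xy≈1 = proj₂ (inverse x≉0)

        y∈ : y ∈ K
        y∈ = ⁻¹-closed x∈ xy≈1

        scale : ∀ {u} → u ∈ K → Fin n → Fin n
        scale u∈ i = to (_ , *-closed u∈ (proj₂ (from i)))

        scale-scale : ∀ {u v} (u∈ : u ∈ K) (v∈ : v ∈ K) → u * v ≈ 1# →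
                      ∀ i → scale u∈ (scale v∈ i) ≡ i
        scale-scale {u} {v} u∈ v∈ uv≈1 i = to-≡ _ (begin
          u * el (scale v∈ i)  ≈⟨ *-congˡ (el-to _) ⟩
          u * (v * el i)       ≈⟨ *-assoc u v _ ⟨
          (u * v) * el i       ≈⟨ *-congʳ uv≈1 ⟩
          1# * el i            ≈⟨ *-identityˡ _ ⟩
          el i                 ∎)

        π : Permutation′ n
        π = permutation (scale x∈) (scale y∈)
              (scale-scale x∈ y∈ xy≈1) (scale-scale y∈ x∈ (trans (*-comm y x) xy≈1))

        corr : ∀ {z} → Dec (z ≈ 0#) → Carrier
        corr (yes _) = x
        corr (no  _) = 1#

        pointwise : ∀ {u v} (u? : Dec (u ≈ 0#)) (v? : Dec (v ≈ 0#)) → v ≈ x * u →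
                    corr u? * unit v? ≈ x * unit u?
        pointwise (yes _)   (yes _)   v≈xu = refl
        pointwise (yes u≈0) (no v≉0) v≈xu = contradiction (trans v≈xu (trans (*-congˡ u≈0) (zeroʳ x))) v≉0
        pointwise (no u≉0) (yes v≈0) v≈xu = contradiction (trans (sym v≈xu) v≈0) (*-≉0 x≉0 u≉0)
        pointwise (no _)    (no _)    v≈xu = trans (*-identityˡ _) v≈xu

        product-corr : Π.sum (corr ∘ 0?) ≈ x
        -- Generalised to any family with exactly one zero, so that its factor can be split off.
        product-corr = go (to (0# , 0∈)) (el-to 0∈)
                          (λ j j≈0 → ≡.sym (to-≡ 0∈ (sym j≈0))) 0?
          where
          go : ∀ {m} {f : Fin m → Carrier} i → f i ≈ 0# → (∀ j → f j ≈ 0# → j ≡ i) →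
               (f? : ∀ j → Dec (f j ≈ 0#)) → Π.sum (corr ∘ f?) ≈ x
          go {suc m} {f} i fi≈0 only f? = begin
            Π.sum (corr ∘ f?)                                  ≈⟨ Π.sum-remove {i = i} (corr ∘ f?) ⟩
            corr (f? i) * Π.sum (corr ∘ f? ∘ punchIn i)
              ≈⟨ *-cong (at i (f? i) fi≈0) (Π.sum-cong-≋ λ j → off (f? (punchIn i j)) (λ z → Fin.punchInᵢ≢i i j (only _ z))) ⟩
            x * Π.sum {m} (λ _ → 1#)                           ≈⟨ *-congˡ (Π.sum-replicate-zero m) ⟩
            x * 1#                                             ≈⟨ *-identityʳ x ⟩
            x                                                  ∎
            where
            at : ∀ j (z? : Dec (f j ≈ 0#)) → f j ≈ 0# → corr z? ≈ x
            at j (yes _)  _   = refl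
            at j (no z≉0) z≈0 = contradiction z≈0 z≉0
            off : ∀ {z} (z? : Dec (z ≈ 0#)) → z ≉ 0# → corr z? ≈ 1#
            off (yes z≈0) z≉0 = contradiction z≈0 z≉0
            off (no _)    _   = refl

      -- All n indices contribute a factor x on the left, and on the right the index of 0
      -- contributes the correction x: x^n P = x P, where P is the product of the nonzero elements.
      fermat-≉0 : x ^ n ≈ x
      fermat-≉0 = *-cancelˡ-≉0 (Π-≉0 (unit ∘ 0?) (unit-≉0 ∘ 0?)) (begin
        P * x ^ n                                             ≈⟨ *-comm P (x ^ n) ⟩
        x ^ n * P                                             ≈⟨ *-congʳ (Π.sum-replicate n) ⟨
        Π.sum {n} (λ _ → x) * P                               ≈⟨ Π.∑-distrib-+ (λ _ → x) (unit ∘ 0?) ⟨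
        Π.sum (λ i → x * unit (0? i))
          ≈⟨ Π.sum-cong-≋ (λ i → pointwise (0? i) (0? (π ⟨$⟩ʳ i)) (el-to _)) ⟨
        Π.sum (λ i → corr (0? i) * unit (0? (π ⟨$⟩ʳ i)))      ≈⟨ Π.∑-distrib-+ (corr ∘ 0?) (unit ∘ 0? ∘ (π ⟨$⟩ʳ_)) ⟩
        Π.sum (corr ∘ 0?) * Π.sum (unit ∘ 0? ∘ (π ⟨$⟩ʳ_))
          ≈⟨ *-cong product-corr (sym (Π.sum-permute (unit ∘ 0?) π)) ⟩
        x * P                                                 ≈⟨ *-comm x P ⟩
        P * x                                                 ∎)
        where
        P : Carrier
        P = Π.sum (unit ∘ 0?)

    fermat : ∀ {x} → x ∈ K → x ^ n ≈ x
    fermat {x} x∈ with to (x , x∈) Fin.≟ to (0# , 0∈)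
    ... | no x≢0 = fermat-≉0 x∈ λ x≈0 → x≢0 (to-cong x≈0)
    ... | yes x≡0 = begin
      x ^ n   ≈⟨ ^-congˡ n x≈0 ⟩
      0# ^ n  ≈⟨ 0^ n (to (0# , 0∈)) ⟩
      0#      ≈⟨ x≈0 ⟨
      x       ∎
      where
      x≈0 : x ≈ 0#
      x≈0 = trans (sym (el-to x∈)) (trans (reflexive (≡.cong el x≡0)) (el-to 0∈))
      -- An element of `Fin m` excludes m = 0, for which the power would be 1.
      0^ : ∀ m → Fin m → 0# ^ m ≈ 0#
      0^ (suc m) _ = zeroˡ (0# ^ m)

  module FiniteField {n : ℕ} (order : HasOrder setoid n) where
    open Inverse order using (to; from; to-cong; from-cong; inverseˡ; inverseʳ; strictlyInverseˡ; strictlyInverseʳ)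

    abstract
      _≟_ : Decidable _≈_
      _≟_ = via-injection (Inverse⇒Injection order) Fin._≟_

    x^n≈x : ∀ x → x ^ n ≈ x
    x^n≈x x = fermat {K = U} improper (record
      { to = to ∘ proj₁ ; from = λ i → from i , tt ; to-cong = to-cong ; from-cong = from-cong
      ; inverse = inverseˡ , inverseʳ }) tt
      where
      improper : IsSubfield L U
      improper = record { }

    -- Every element is its own n-th power, and an even power of -1 is 1; hence -1 = 1.
    even⇒1+1≈0 : ∀ k → n ≡ 2 ℕ.* k → 1# + 1# ≈ 0#
    even⇒1+1≈0 k n≡2k = begin
      1# + 1#              ≈⟨ +-congˡ 1≈-1 ⟩
      1# + - 1#            ≈⟨ -‿inverseʳ 1# ⟩
      0#                   ∎
      where
      open RingProperties ring using (-1*x≈-x; -‿involutive)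
      1≈-1 : 1# ≈ - 1#
      1≈-1 = begin
        1#                 ≈⟨ 1^n≈1 k ⟨
        1# ^ k             ≈⟨ ^-congˡ k (trans (*-congˡ (*-identityʳ (- 1#))) (trans (-1*x≈-x _) (-‿involutive 1#))) ⟨
        ((- 1#) ^ 2) ^ k     ≈⟨ ^-assocʳ (- 1#) 2 k ⟩
        (- 1#) ^ (2 ℕ.* k)   ≈⟨ ^-congʳ (- 1#) n≡2k ⟨
        (- 1#) ^ n           ≈⟨ x^n≈x (- 1#) ⟩
        - 1#               ∎

-- Characteristic two: identities over 𝔽₂, traces, additive Hilbert 90

HasCharacteristicTwo : ∀ {c ℓ} → CommutativeRing c ℓ → Set ℓ
HasCharacteristicTwo L = 1# + 1# ≈ 0#
  where open CommutativeRing L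

module CharacteristicTwo {c ℓ} (L : CommutativeRing c ℓ)
  (1+1≈0 : HasCharacteristicTwo L) where
  open CommutativeRing L
  open RingProperties ring using (+-cancelʳ)
  open SemiringExp semiring using (_^_; ^-congˡ; ^-congʳ; ^-homo-*)
  open CommutativeSemiringExp commutativeSemiring using (^-distrib-*)
  open import Relation.Binary.Reasoning.Setoid setoid

  x+x≈0 : ∀ x → x + x ≈ 0#
  x+x≈0 x = begin
    x + x            ≈⟨ +-cong (*-identityʳ x) (*-identityʳ x) ⟨
    x * 1# + x * 1#  ≈⟨ distribˡ x 1# 1# ⟨
    x * (1# + 1#)    ≈⟨ *-congˡ 1+1≈0 ⟩
    x * 0#           ≈⟨ zeroʳ x ⟩
    0#               ∎

  -- With coefficients in 𝔽₂, the normal forms take 1 + 1 ≈ 0 into account.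
  module 𝔽₂-Solver where
    𝔽₂ : RawRing _ _
    𝔽₂ = record
      { Carrier = Bool ; _≈_ = _≡_ ; _+_ = _xor_ ; _*_ = _∧_ ; -_ = id ; 0# = false ; 1# = true }

    ⟦_⟧ : Bool → Carrier
    ⟦ true  ⟧ = 1#
    ⟦ false ⟧ = 0#

    +-homo : ∀ x y → ⟦ x xor y ⟧ ≈ ⟦ x ⟧ + ⟦ y ⟧
    +-homo true  true  = sym 1+1≈0
    +-homo true  false = sym (+-identityʳ 1#)
    +-homo false y     = sym (+-identityˡ ⟦ y ⟧)

    *-homo : ∀ x y → ⟦ x ∧ y ⟧ ≈ ⟦ x ⟧ * ⟦ y ⟧
    *-homo true  y = sym (*-identityˡ ⟦ y ⟧)
    *-homo false y = sym (zeroˡ ⟦ y ⟧)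

    -‿homo : ∀ x → ⟦ x ⟧ ≈ - ⟦ x ⟧
    -‿homo x = +-cancelʳ ⟦ x ⟧ _ _ (trans (x+x≈0 ⟦ x ⟧) (sym (-‿inverseˡ ⟦ x ⟧)))

    morphism : 𝔽₂ -Raw-AlmostCommutative⟶ fromCommutativeRing L
    morphism = record
      { ⟦_⟧ = ⟦_⟧ ; +-homo = +-homo ; *-homo = *-homo ; -‿homo = -‿homo
      ; 0-homo = refl ; 1-homo = refl }

    _≟-coeff_ : ∀ x y → _
    x ≟-coeff y with x Bool.≟ y
    ... | yes x≡y = just (reflexive (≡.cong ⟦_⟧ x≡y))
    ... | no  _   = nothing

    open Algebra.Solver.Ring 𝔽₂ (fromCommutativeRing L) morphism _≟-coeff_ public
      using (_:=_; _:+_; _:*_; con)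
    open Algebra.Solver.Ring 𝔽₂ (fromCommutativeRing L) morphism _≟-coeff_
      using (Polynomial; var; normalise; ⟦_⟧↓; ⟦_⟧N; correct) renaming (⟦_⟧ to ⟦_⟧P)
    open Reflection setoid var ⟦_⟧P ⟦_⟧↓ correct using (close)

    -- Compares normal forms as data, which is much cheaper than the comparison of
    -- their values made by the library's solve.
    solve : ∀ n (f : N-ary n (Polynomial n) (Polynomial n × Polynomial n)) →
            normalise (proj₁ (close n f)) ≡ normalise (proj₂ (close n f)) →
            Eq n _≈_ (curryⁿ ⟦ proj₁ (close n f) ⟧P) (curryⁿ ⟦ proj₂ (close n f) ⟧P)
    solve n f nf≡ = curryⁿ-cong _≈_ ⟦ p₁ ⟧P ⟦ p₂ ⟧P λ ρ →
      trans (sym (correct p₁ ρ)) (trans (reflexive (≡.cong (λ p → ⟦ p ⟧N ρ) nf≡)) (correct p₂ ρ))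
      where
      p₁ p₂ : Polynomial n
      p₁ = proj₁ (close n f)
      p₂ = proj₂ (close n f)

  open 𝔽₂-Solver using (solve; _:=_; _:+_; _:*_; con)

  ≈⇒+≈0 : ∀ {x y} → x ≈ y → x + y ≈ 0#
  ≈⇒+≈0 {x} {y} x≈y = trans (+-congʳ x≈y) (x+x≈0 y)

  +≈0⇒≈ : ∀ {x y} → x + y ≈ 0# → x ≈ y
  +≈0⇒≈ {x} {y} x+y≈0 = +-cancelʳ y x y (trans x+y≈0 (sym (x+x≈0 y)))

  -- An equation may be used with any multiplier, once the identity that remains
  -- is one of polynomials over 𝔽₂.
  modulo : ∀ {x y k a b} → a ≈ b → x ≈ y + k * (a + b) → x ≈ y
  modulo {x} {y} {k} {a} {b} a≈b x≈ = begin
    x                ≈⟨ x≈ ⟩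
    y + k * (a + b)  ≈⟨ +-congˡ (*-congˡ (≈⇒+≈0 a≈b)) ⟩
    y + k * 0#       ≈⟨ +-congˡ (zeroʳ k) ⟩
    y + 0#           ≈⟨ +-identityʳ y ⟩
    y                ∎

  square-+ : ∀ x y → (x + y) * (x + y) ≈ x * x + y * y
  square-+ = solve 2 (λ x y → (x :+ y) :* (x :+ y) := x :* x :+ y :* y) ≡.refl

  ^2^suc : ∀ x k → x ^ (2 ℕ.^ suc k) ≈ x ^ (2 ℕ.^ k) * x ^ (2 ℕ.^ k)
  ^2^suc x k = trans (^-homo-* x (2 ℕ.^ k) _)
                     (*-congˡ (^-congʳ x (ℕ.+-identityʳ (2 ℕ.^ k))))

  ^2^-+ : ∀ k x y → (x + y) ^ (2 ℕ.^ k) ≈ x ^ (2 ℕ.^ k) + y ^ (2 ℕ.^ k)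
  ^2^-+ zero    x y = trans (*-identityʳ (x + y)) (sym (+-cong (*-identityʳ x) (*-identityʳ y)))
  ^2^-+ (suc k) x y = begin
    (x + y) ^ (2 ℕ.^ suc k)                                        ≈⟨ ^2^suc (x + y) k ⟩
    (x + y) ^ (2 ℕ.^ k) * (x + y) ^ (2 ℕ.^ k)                      ≈⟨ *-cong (^2^-+ k x y) (^2^-+ k x y) ⟩
    (x ^ (2 ℕ.^ k) + y ^ (2 ℕ.^ k)) * (x ^ (2 ℕ.^ k) + y ^ (2 ℕ.^ k))  ≈⟨ square-+ _ _ ⟩
    x ^ (2 ℕ.^ k) * x ^ (2 ℕ.^ k) + y ^ (2 ℕ.^ k) * y ^ (2 ℕ.^ k)  ≈⟨ +-cong (^2^suc x k) (^2^suc y k) ⟨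
    x ^ (2 ℕ.^ suc k) + y ^ (2 ℕ.^ suc k)                          ∎

  -- The length is left free for induction: length s gives the absolute trace of K, length 2s that
  -- of L.
  Tr : ℕ → Carrier → Carrier
  Tr k = Presemifields.tr k L

  Tr-cong : ∀ k {x y} → x ≈ y → Tr k x ≈ Tr k y
  Tr-cong k x≈y = sum-cong-≋ {k} λ i → ^-congˡ (2 ℕ.^ toℕ i) x≈y
    where open SemiringSum semiring using (sum-cong-≋)

  Tr-suc : ∀ k x → Tr (suc k) x ≈ Tr k x + x ^ (2 ℕ.^ k)
  Tr-suc k x = trans (sum-init-last {k} (λ i → x ^ (2 ℕ.^ toℕ i)))
    (+-cong (sum-cong-≋ {k} λ i → ^-congʳ x (≡.cong (2 ℕ.^_) (Fin.toℕ-inject₁ i)))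
            (^-congʳ x (≡.cong (2 ℕ.^_) (Fin.toℕ-fromℕ k))))
    where open SemiringSum semiring using (sum-init-last; sum-cong-≋)

  -- Squaring shifts the exponents by one place: the term x is lost and x^(2^k) is gained.
  Tr-square : ∀ k x → Tr k x * Tr k x ≈ Tr k x + x + x ^ (2 ℕ.^ k)
  Tr-square zero    x = begin
    0# * 0#           ≈⟨ solve 1 (λ x → con false :* con false := con false :+ x :+ x :* con true) ≡.refl x ⟩
    0# + x + x * 1#   ∎
  Tr-square (suc k) x = begin
    Tr (suc k) x * Tr (suc k) x                    ≈⟨ *-cong (Tr-suc k x) (Tr-suc k x) ⟩
    (Tr k x + y) * (Tr k x + y)                    ≈⟨ square-+ (Tr k x) y ⟩
    Tr k x * Tr k x + y * y                        ≈⟨ +-cong (Tr-square k x) (sym (^2^suc x k)) ⟩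
    Tr k x + x + y + x ^ (2 ℕ.^ suc k)             ≈⟨ solve 4 (λ t x y z →
              t :+ x :+ y :+ z := t :+ y :+ x :+ z) ≡.refl (Tr k x) x y _ ⟩
    Tr k x + y + x + x ^ (2 ℕ.^ suc k)             ≈⟨ +-congʳ (+-congʳ (Tr-suc k x)) ⟨
    Tr (suc k) x + x + x ^ (2 ℕ.^ suc k)           ∎
    where
    y : Carrier
    y = x ^ (2 ℕ.^ k)

  -- The sum telescopes.
  Tr-x²+x : ∀ k x → Tr k (x * x + x) ≈ x ^ (2 ℕ.^ k) + x
  Tr-x²+x zero    x = sym (trans (+-congʳ (*-identityʳ x)) (x+x≈0 x))
  Tr-x²+x (suc k) x = begin
    Tr (suc k) (x * x + x)                              ≈⟨ Tr-suc k _ ⟩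
    Tr k (x * x + x) + (x * x + x) ^ (2 ℕ.^ k)
      ≈⟨ +-cong (Tr-x²+x k x) (trans (^2^-+ k _ x) (+-congʳ (^-distrib-* x x (2 ℕ.^ k)))) ⟩
    (y + x) + (y * y + y)                               ≈⟨ solve 2 (λ x y →
              (y :+ x) :+ (y :* y :+ y) := y :* y :+ x) ≡.refl x y ⟩
    y * y + x                                           ≈⟨ +-congʳ (^2^suc x k) ⟨
    x ^ (2 ℕ.^ suc k) + x                               ∎
    where
    y : Carrier
    y = x ^ (2 ℕ.^ k)

  -- The terms repeat with period s, so the two halves of the sum are equal and cancel.
  Tr-double : ∀ s {x} → x ^ (2 ℕ.^ s) ≈ x → Tr (s ℕ.+ s) x ≈ 0#
  Tr-double s {x} x^2^s≈x = trans (go s) (x+x≈0 (Tr s x))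
    where
    shift : ∀ k → x ^ (2 ℕ.^ (k ℕ.+ s)) ≈ x ^ (2 ℕ.^ k)
    shift zero    = trans x^2^s≈x (sym (*-identityʳ x))
    shift (suc k) = trans (^2^suc x (k ℕ.+ s))
                      (trans (*-cong (shift k) (shift k)) (sym (^2^suc x k)))
    go : ∀ k → Tr (k ℕ.+ s) x ≈ Tr k x + Tr s x
    go zero    = sym (+-identityˡ _)
    go (suc k) = begin
      Tr (suc (k ℕ.+ s)) x                       ≈⟨ Tr-suc (k ℕ.+ s) x ⟩
      Tr (k ℕ.+ s) x + x ^ (2 ℕ.^ (k ℕ.+ s))     ≈⟨ +-cong (go k) (shift k) ⟩
      Tr k x + Tr s x + x ^ (2 ℕ.^ k)            ≈⟨ solve 3 (λ t u y →
                t :+ u :+ y := t :+ y :+ u) ≡.refl (Tr k x) (Tr s x) _ ⟩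
      Tr k x + x ^ (2 ℕ.^ k) + Tr s x            ≈⟨ +-congʳ (Tr-suc k x) ⟨
      Tr (suc k) x + Tr s x                      ∎

  -- Additive Hilbert 90: x is Σ_{j<i<n} c^(2^j) θ^(2^i).
  hilbert90 : ∀ n {θ c} → θ ^ (2 ℕ.^ n) ≈ θ → Tr n θ ≈ 1# → Tr n c ≈ 0# →
              ∃[ x ] x * x + x ≈ c
  hilbert90 n {θ} {c} θ^2^n≈θ Trθ≈1 Trc≈0 = X n , (begin
    X n * X n + X n                                        ≈⟨ X²+X n ⟩
    c * (Tr n θ + θ) + θ ^ (2 ℕ.^ n) * (Tr n c + c)
      ≈⟨ +-cong (*-congˡ (+-congʳ Trθ≈1)) (*-cong θ^2^n≈θ (+-congʳ Trc≈0)) ⟩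
    c * (1# + θ) + θ * (0# + c)                            ≈⟨ solve 2 (λ c θ →
              c :* (con true :+ θ) :+ θ :* (con false :+ c) := c) ≡.refl c θ ⟩
    c                                                      ∎)
    where
    X : ℕ → Carrier
    X zero    = 0#
    X (suc k) = X k + Tr k c * θ ^ (2 ℕ.^ k)

    -- Squaring raises both indices of the double sum by one. All terms cancel except those of `X k`
    -- with j = 0 and those of its square with i = k.
    X²+X : ∀ k → X k * X k + X k ≈ c * (Tr k θ + θ) + θ ^ (2 ℕ.^ k) * (Tr k c + c)
    X²+X zero    = solve 2 (λ c θ → con false :* con false :+ con false :=
                     c :* (con false :+ θ) :+ (θ :* con true) :* (con false :+ c)) ≡.refl c θ
    X²+X (suc k) = begin
      X (suc k) * X (suc k) + X (suc k)
        ≈⟨ solve 3 (λ x t y →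
                  (x :+ t :* y) :* (x :+ t :* y) :+ (x :+ t :* y)
                  := (x :* x :+ x) :+ (t :* t :* (y :* y) :+ t :* y)) ≡.refl (X k) (Tr k c) y ⟩
      (X k * X k + X k) + (Tr k c * Tr k c * (y * y) + Tr k c * y)
        ≈⟨ +-cong (X²+X k) (+-congʳ (*-congʳ (Tr-square k c))) ⟩
      (c * (Tr k θ + θ) + y * (Tr k c + c)) + ((Tr k c + c + c ^ (2 ℕ.^ k)) * (y * y) + Tr k c * y)
        ≈⟨ solve 6 (λ c s θ y t d → (c :* (s :+ θ) :+ y :* (t :+ c)) :+ ((t :+ c :+ d) :* (y :* y) :+ t :* y)
                                 := c :* (s :+ y :+ θ) :+ (y :* y) :* (t :+ d :+ c)) ≡.refl c (Tr k θ) θ y (Tr k c) (c ^ (2 ℕ.^ k)) ⟩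
      c * (Tr k θ + y + θ) + (y * y) * (Tr k c + c ^ (2 ℕ.^ k) + c)
        ≈⟨ +-cong (*-congˡ (+-congʳ (Tr-suc k θ))) (*-cong (^2^suc θ k) (+-congʳ (Tr-suc k c))) ⟨
      c * (Tr (suc k) θ + θ) + θ ^ (2 ℕ.^ suc k) * (Tr (suc k) c + c)  ∎
      where
      y : Carrier
      y = θ ^ (2 ℕ.^ k)

-- Number of roots of a monic polynomial

module MonicPolynomials {c ℓ} (L : CommutativeRing c ℓ) where
  open CommutativeRing L
  open SemiringExp semiring using (_^_)
  open import Relation.Binary.Reasoning.Setoid setoid
  open import Algebra.Solver.Ring.NaturalCoefficients.Default commutativeSemiring
    using (solve; _:=_; _:+_; _:*_)

  -- Horner form, ending in the leading coefficient 1; the index is the degree. Being a predicate on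
  -- functions, it applies directly to traces.
  data Monic : ℕ → (Carrier → Carrier) → Set (c ⊔ ℓ) where
    one  : ∀ {f} → (∀ x → f x ≈ 1#) → Monic 0 f
    step : ∀ {n f g} a → Monic n g → (∀ x → f x ≈ a + x * g x) → Monic (suc n) f

  Monic-resp : ∀ {n f g} → (∀ x → g x ≈ f x) → Monic n f → Monic n g
  Monic-resp g≈f (one f≈1)      = one (λ x → trans (g≈f x) (f≈1 x))
  Monic-resp g≈f (step a mh f≈) = step a mh (λ x → trans (g≈f x) (f≈ x))

  Monic-^ : ∀ n → Monic n (_^ n)
  Monic-^ zero    = one (λ _ → refl)
  Monic-^ (suc n) = step 0# (Monic-^ n) (λ x → sym (+-identityˡ _))

  Monic-+ : ∀ {m n f g} r → Monic n f → Monic m g → m ℕ.< n →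
            Monic n (λ x → f x + r * g x)
  Monic-+ {f = f} {g} r (step {g = h} a mh f≈) (one g≈1) _ = step (a + r) mh λ x → begin
    f x + r * g x          ≈⟨ +-cong (f≈ x) (trans (*-congˡ (g≈1 x)) (*-identityʳ r)) ⟩
    a + x * h x + r        ≈⟨ solve 3 (λ a y r → a :+ y :+ r := a :+ r :+ y) refl a (x * h x) r ⟩
    a + r + x * h x        ∎
  Monic-+ {f = f} {g} r (step {g = h} a mh f≈) (step {g = k} b mk g≈) (ℕ.s≤s m<n) =
    step (a + r * b) (Monic-+ r mh mk m<n) λ x → begin
    f x + r * g x                              ≈⟨ +-cong (f≈ x) (*-congˡ (g≈ x)) ⟩
    a + x * h x + r * (b + x * k x)            ≈⟨ solve 6 (λ a b r x y z →
              a :+ x :* y :+ r :* (b :+ x :* z)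
              := a :+ r :* b :+ x :* (y :+ r :* z)) refl a b r x (h x) (k x) ⟩
    a + r * b + x * (h x + r * k x)            ∎

  -- f x - f r = (x - r) g x, with both sides moved so that no subtraction occurs.
  divide : ∀ {n f} r → Monic (suc n) f →
           ∃[ g ] Monic n g × (∀ x → f x + r * g x ≈ f r + x * g x)
  divide {zero}  {f} r (step {g = g} a mg f≈) = g , mg , λ x → begin
    f x + r * g x              ≈⟨ +-congʳ (f≈ x) ⟩
    a + x * g x + r * g x      ≈⟨ +-congˡ (*-congˡ (constant mg x r)) ⟩
    a + x * g x + r * g r      ≈⟨ solve 3 (λ a y z → a :+ y :+ z := a :+ z :+ y) refl a (x * g x) (r * g r) ⟩
    a + r * g r + x * g x      ≈⟨ +-congʳ (f≈ r) ⟨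
    f r + x * g x              ∎
    where
    constant : ∀ {g} → Monic 0 g → ∀ x y → g x ≈ g y
    constant (one g≈1) x y = trans (g≈1 x) (sym (g≈1 y))
  divide {suc n} {f} r (step {g = g} a mg f≈) with h , mh , h≈ ← divide r mg =
    (λ x → g x + r * h x) , Monic-+ r mg mh ℕ.≤-refl , λ x → begin
    f x + r * (g x + r * h x)                  ≈⟨ +-cong (f≈ x) (*-congˡ (h≈ x)) ⟩
    a + x * g x + r * (g r + x * h x)          ≈⟨ solve 6 (λ a x r y z w →
              a :+ x :* y :+ r :* (z :+ x :* w)
              := a :+ r :* z :+ x :* (y :+ r :* w)) refl a x r (g x) (g r) (h x) ⟩
    a + r * g r + x * (g x + r * h x)          ≈⟨ +-congʳ (f≈ r) ⟨
    f r + x * (g x + r * h x)                  ∎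

  -- Induction on the degree: after division by x - r 0, the other points are roots of the quotient,
  -- because they differ from r 0.
  monic-roots : IsField L → Decidable _≈_ → ∀ {n f} → Monic n f → (r : Fin (suc n) → Carrier) →
                (∀ {i j} → r i ≈ r j → i ≡ j) → ¬ (∀ i → f (r i) ≈ 0#)
  monic-roots isField _≟_ (one f≈1) r r-inj roots =
    IsField.1≉0 isField (trans (sym (f≈1 _)) (roots Fin.zero))
  monic-roots isField _≟_ {f = f} mf@(step _ _ _) r r-inj roots
    with g , mg , g≈ ← divide (r Fin.zero) mf =
    monic-roots isField _≟_ mg (r ∘ Fin.suc) (λ eq → Fin.suc-injective (r-inj eq)) root
    where
    open FieldProperties L isField
    root : ∀ i → g (r (Fin.suc i)) ≈ 0#
    root i with g (r (Fin.suc i)) ≟ 0#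
    ... | yes gy≈0 = gy≈0
    ... | no  gy≉0 = contradiction (r-inj (*-cancelˡ-≉0 gy≉0 (begin
      g y * z        ≈⟨ *-comm (g y) z ⟩
      z * g y        ≈⟨ +-identityˡ _ ⟨
      0# + z * g y   ≈⟨ +-congʳ (roots (Fin.suc i)) ⟨
      f y + z * g y  ≈⟨ g≈ y ⟩
      f z + y * g y  ≈⟨ +-congʳ (roots Fin.zero) ⟩
      0# + y * g y   ≈⟨ +-identityˡ _ ⟩
      y * g y        ≈⟨ *-comm y (g y) ⟩
      g y * y        ∎))) λ ()
      where
      y z : Carrier
      y = r (Fin.suc i)
      z = r Fin.zero

-- Square roots and Artin-Schreier equations in the field of order q²

module FieldOfOrderSquare {c ℓ} (s : ℕ) (1≤s : 1 ℕ.≤ s)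
  (L : CommutativeRing c ℓ) (isField : IsField L)
  (order : HasOrder (CommutativeRing.setoid L) ((2 ℕ.^ s) ℕ.^ 2)) where
  open CommutativeRing L
  open SemiringExp semiring using (_^_; ^-congʳ; ^-assocʳ)
  open FieldProperties L isField using (module FiniteField; *-cancelˡ-≉0)
  open FiniteField order public using (_≟_)
  open FiniteField order using (x^n≈x; even⇒1+1≈0)
  open import Relation.Binary.Reasoning.Setoid setoid

  private
    q : ℕ
    q = 2 ℕ.^ s

    q²≡ : q ℕ.^ 2 ≡ 2 ℕ.^ (s ℕ.+ s)
    q²≡ = ≡.trans (≡.cong (q ℕ.*_) (ℕ.*-identityʳ q)) (≡.sym (ℕ.^-distribˡ-+-* 2 s s))

    -- The degree 2s of L over 𝔽₂ is needed as a successor: the power 2^t is the square root, and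
    -- 2^t is the degree of the trace of L as a polynomial.
    half : ∃[ t ] s ℕ.+ s ≡ suc t
    half = ℕ.pred (s ℕ.+ s) , ≡.sym (ℕ.suc-pred (s ℕ.+ s) {{ℕ.>-nonZero (ℕ.≤-trans 1≤s (ℕ.m≤m+n s s))}})

    t : ℕ
    t = proj₁ half

    q²≡2^suc : q ℕ.^ 2 ≡ 2 ℕ.^ suc t
    q²≡2^suc = ≡.trans q²≡ (≡.cong (2 ℕ.^_) (proj₂ half))

  abstract
    1+1≈0 : 1# + 1# ≈ 0#
    1+1≈0 = even⇒1+1≈0 (2 ℕ.^ t) q²≡2^suc

  open CharacteristicTwo L 1+1≈0
  open MonicPolynomials L

  conj-conj : ∀ x → (x ^ q) ^ q ≈ x
  conj-conj x = begin
    (x ^ q) ^ q     ≈⟨ ^-assocʳ x q q ⟩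
    x ^ (q ℕ.* q)   ≈⟨ ^-congʳ x (≡.cong (q ℕ.*_) (ℕ.*-identityʳ q)) ⟨
    x ^ (q ℕ.^ 2)   ≈⟨ x^n≈x x ⟩
    x               ∎

  abstract
    √ : ∀ x → ∃[ y ] y * y ≈ x
    √ x = x ^ (2 ℕ.^ t) , (begin
      x ^ (2 ℕ.^ t) * x ^ (2 ℕ.^ t)  ≈⟨ ^2^suc x t ⟨
      x ^ (2 ℕ.^ suc t)              ≈⟨ ^-congʳ x q²≡2^suc ⟨
      x ^ (q ℕ.^ 2)                  ≈⟨ x^n≈x x ⟩
      x                              ∎)

  private
    monic-Tr : ∀ k → Monic (2 ℕ.^ k) (Tr (suc k))
    monic-Tr zero    = Monic-resp (λ x → +-identityʳ (x ^ 1)) (Monic-^ 1)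
    monic-Tr (suc k) = Monic-resp
      (λ x → trans (Tr-suc (suc k) x) (trans (+-comm _ _) (+-congˡ (sym (*-identityˡ _)))))
      (Monic-+ 1# (Monic-^ (2 ℕ.^ suc k)) (monic-Tr k)
        (ℕ.^-monoʳ-< 2 (ℕ.s≤s (ℕ.s≤s ℕ.z≤n)) (ℕ.n<1+n k)))

    θ^2^≈θ : ∀ θ → θ ^ (2 ℕ.^ suc t) ≈ θ
    θ^2^≈θ θ = trans (^-congʳ θ (≡.sym q²≡2^suc)) (x^n≈x θ)

    -- The trace has degree 2^t, which is less than the order of L, so it cannot vanish on 2^t + 1
    -- elements. Its values satisfy T² = T, so a nonzero value is 1.
    trace-one : ∃[ θ ] Tr (suc t) θ ≈ 1#
    trace-one = let i , Tri≉0 = Fin.¬∀⟶∃¬ _ (λ i → Tr (suc t) (r i) ≈ 0#) (λ _ → _ ≟ 0#)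
                                  (monic-roots isField _≟_ (monic-Tr t) r r-inj)
                in r i , *-cancelˡ-≉0 Tri≉0 (one-or-zero (r i))
      where
      open Inverse order
      2^t<q² : 2 ℕ.^ t ℕ.< q ℕ.^ 2
      2^t<q² = ≡.subst (2 ℕ.^ t ℕ.<_) (≡.sym q²≡2^suc)
                 (ℕ.^-monoʳ-< 2 (ℕ.s≤s (ℕ.s≤s ℕ.z≤n)) (ℕ.n<1+n t))
      r : Fin (suc (2 ℕ.^ t)) → Carrier
      r i = from (Fin.inject≤ i 2^t<q²)
      r-inj : ∀ {i j} → r i ≈ r j → i ≡ j
      r-inj {i} {j} eq = Fin.inject≤-injective 2^t<q² 2^t<q² i j
        (≡.trans (≡.sym (strictlyInverseˡ _)) (≡.trans (to-cong eq) (strictlyInverseˡ _)))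
      one-or-zero : ∀ x → Tr (suc t) x * Tr (suc t) x ≈ Tr (suc t) x * 1#
      one-or-zero x = begin
        T * T                           ≈⟨ Tr-square (suc t) x ⟩
        T + x + x ^ (2 ℕ.^ suc t)       ≈⟨ +-congˡ (θ^2^≈θ x) ⟩
        T + x + x                       ≈⟨ +-assoc T x x ⟩
        T + (x + x)                     ≈⟨ +-congˡ (x+x≈0 x) ⟩
        T + 0#                          ≈⟨ +-identityʳ T ⟩
        T                               ≈⟨ *-identityʳ T ⟨
        T * 1#                          ∎
        where
        T : Carrier
        T = Tr (suc t) x

  abstract
    -- An element of K has trace 0 from L to 𝔽₂, so additive Hilbert 90 applies. The solution lies
    -- in L, not necessarily in K.
    artin-schreier : ∀ c → c ^ q ≈ c → ∃[ x ] x * x + x ≈ c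
    artin-schreier c c^q≈c = hilbert90 (suc t) (θ^2^≈θ _) (proj₂ trace-one)
      (trans (reflexive (≡.cong (λ n → Tr n c) (≡.sym (proj₂ half)))) (Tr-double s c^q≈c))

-- Additive bijections and composition of isotopies

module _ {c ℓ} (G : AbelianGroup c ℓ) where
  open AbelianGroup G
  open GroupProperties group using (identityʳ-unique; inverseˡ-unique)

  additiveIso : ∀ {f : Carrier → Carrier} (g : Carrier → Carrier) → (∀ {x y} → x ≈ y → f x ≈ f y) → (∀ {x y} → x ≈ y → g x ≈ g y) →
                (∀ x y → f (x ∙ y) ≈ f x ∙ f y) →
                (∀ x → f (g x) ≈ x) → (∀ x → g (f x) ≈ x) →
                IsGroupIsomorphism rawGroup rawGroup f
  additiveIso {f} g f-cong g-cong homo fg gf = record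
    { isGroupMonomorphism = record
      { isGroupHomomorphism = record
        { isMonoidHomomorphism = record
          { isMagmaHomomorphism = record
            { isRelHomomorphism = record { cong = f-cong } ; homo = homo }
          ; ε-homo = ε-homo }
        ; ⁻¹-homo = λ x → inverseˡ-unique (f (x ⁻¹)) (f x)
            (trans (sym (homo (x ⁻¹) x)) (trans (f-cong (inverseˡ x)) ε-homo)) }
      ; injective = λ fx≈fy → trans (sym (gf _)) (trans (g-cong fx≈fy) (gf _)) }
    ; surjective = λ y → g y , λ z≈gy → trans (f-cong z≈gy) (fg y) }
    where
    ε-homo : f ε ≈ ε
    ε-homo = identityʳ-unique (f ε) (f ε) (trans (sym (homo ε ε)) (f-cong (identityˡ ε)))

  Isotopic-trans : ∀ {_*_ _∘_ _⊛_ : Op₂ Carrier} →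
                   Isotopic G _*_ _∘_ → Isotopic G _∘_ _⊛_ → Isotopic G _*_ _⊛_
  Isotopic-trans I J = record
    { α₁ = I.α₁ ∘ J.α₁
    ; α₂ = I.α₂ ∘ J.α₂
    ; β  = J.β ∘ I.β
    ; α₁-isIsomorphism = Composition.isGroupIsomorphism trans J.α₁-isIsomorphism I.α₁-isIsomorphism
    ; α₂-isIsomorphism = Composition.isGroupIsomorphism trans J.α₂-isIsomorphism I.α₂-isIsomorphism
    ; β-isIsomorphism  = Composition.isGroupIsomorphism trans I.β-isIsomorphism J.β-isIsomorphism
    ; isotopy = λ x y → trans (IsGroupIsomorphism.⟦⟧-cong J.β-isIsomorphism (I.isotopy (J.α₁ x) (J.α₂ y)))
                              (J.isotopy x y)
    }
    where
    module I = Isotopic I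
    module J = Isotopic J

-- Conjugation, norms and conjugate zeros

module Conjugation {c ℓ} (s : ℕ) (1≤s : 1 ℕ.≤ s)
  (L : CommutativeRing c ℓ) (isField : IsField L)
  (order : HasOrder (CommutativeRing.setoid L) ((2 ℕ.^ s) ℕ.^ 2)) where
  open CommutativeRing L public
  open IsField isField public using (1≉0)
  open FieldProperties L isField public
    using (inverse; inverse-≉0; *-cancelˡ-≉0; *-≉0; 1^n≈1)
  open FieldOfOrderSquare s 1≤s L isField order public
  open CharacteristicTwo L 1+1≈0 public
  open 𝔽₂-Solver public using (solve; _:=_; _:+_; _:*_; con)
  open SemiringExp semiring public using (_^_; ^-congˡ; ^-congʳ; ^-homo-*)
  open Presemifields s L public
  open CommutativeSemiringExp commutativeSemiring using (^-distrib-*)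
  open import Relation.Binary.Reasoning.Setoid setoid

  infix 9 _ᵠ

  _ᵠ : Carrier → Carrier
  x ᵠ = x ^ q

  ᵠ-cong : ∀ {x y} → x ≈ y → x ᵠ ≈ y ᵠ
  ᵠ-cong = ^-congˡ q

  -- The conjugates of the parts are parameters, so that a proof conjugating a compound term follows
  -- the syntax of the term.
  ᵠ-+ : ∀ {x y x′ y′} → x ᵠ ≈ x′ → y ᵠ ≈ y′ → (x + y) ᵠ ≈ x′ + y′
  ᵠ-+ {x} {y} x≈ y≈ = trans (^2^-+ s x y) (+-cong x≈ y≈)

  ᵠ-* : ∀ {x y x′ y′} → x ᵠ ≈ x′ → y ᵠ ≈ y′ → (x * y) ᵠ ≈ x′ * y′
  ᵠ-* {x} {y} x≈ y≈ = trans (^-distrib-* x y q) (*-cong x≈ y≈)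

  1ᵠ : 1# ᵠ ≈ 1#
  1ᵠ = 1^n≈1 q

  0ᵠ : 0# ᵠ ≈ 0#
  0ᵠ = trans (ᵠ-cong (sym 1+1≈0)) (trans (ᵠ-+ 1ᵠ 1ᵠ) 1+1≈0)

  ᵠ-≉0 : ∀ {x} → x ≉ 0# → x ᵠ ≉ 0#
  ᵠ-≉0 x≉0 xᵠ≈0 = x≉0 (trans (sym (conj-conj _)) (trans (ᵠ-cong xᵠ≈0) 0ᵠ))

  square-injective : ∀ {x y} → x * x ≈ y * y → x ≈ y
  square-injective {x} {y} xx≈yy with (x + y) ≟ 0#
  ... | yes x+y≈0 = +≈0⇒≈ x+y≈0
  ... | no  x+y≉0 = contradiction (trans (square-+ x y) (≈⇒+≈0 xx≈yy)) (*-≉0 x+y≉0 x+y≉0)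

  -- Both y and yᵠ square to x, and square roots are unique.
  √-real : ∀ {x y} → x ᵠ ≈ x → y * y ≈ x → y ᵠ ≈ y
  √-real xᵠ≈x yy≈x = square-injective
    (trans (sym (ᵠ-* refl refl)) (trans (ᵠ-cong yy≈x) (trans xᵠ≈x (sym yy≈x))))

  inverse-real : ∀ {x y} → x ᵠ ≈ x → x * y ≈ 1# → y ᵠ ≈ y
  inverse-real {x} {y} xᵠ≈x xy≈1 = *-cancelˡ-≉0 (inverse-≉0 (trans (*-comm y x) xy≈1))
    (trans (sym (ᵠ-* xᵠ≈x refl)) (trans (ᵠ-cong xy≈1) (trans 1ᵠ (sym xy≈1))))

  τ-real : ∀ x → τ x ᵠ ≈ τ x
  τ-real x = trans (ᵠ-+ refl (conj-conj x)) (+-comm _ _)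

  -- The added term lies in K, where τ vanishes. It is by such a term that w and μ differ.
  τ-shift : ∀ {x} → x ᵠ ≈ x → ∀ y → τ (y + x * x * τ y) ≈ τ y
  τ-shift {x} xᵠ≈x y = trans (+-congˡ (ᵠ-+ refl (ᵠ-* (ᵠ-* xᵠ≈x xᵠ≈x) (τ-real y))))
    (solve 3 (λ x y Y → (y :+ x :* x :* (y :+ Y)) :+ (Y :+ x :* x :* (y :+ Y)) := y :+ Y) ≡.refl x y (y ᵠ))

  norm-real : ∀ x → (x * x ᵠ) ᵠ ≈ x * x ᵠ
  norm-real x = trans (ᵠ-* refl (conj-conj x)) (*-comm _ _)

  *-^[q-1] : ∀ x → x * x ^ (q ℕ.∸ 1) ≈ x ᵠ
  *-^[q-1] x = ^-congʳ x (ℕ.suc-pred q {{ℕ.m^n≢0 2 s}})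

  -- Hilbert 90: if l ≠ 1 has norm 1 then l = v^(q-1) for v = 1 + lᵠ.
  norm-one⇒IsPower : ∀ {l} → l * l ᵠ ≈ 1# → IsPower[q-1] l
  norm-one⇒IsPower {l} N≈1 with l ≟ 1#
  ... | yes l≈1 = 1# , 1≉0 , trans (1^n≈1 (q ℕ.∸ 1)) (sym l≈1)
  ... | no  l≉1 = v , v≉0 , *-cancelˡ-≉0 v≉0 (begin
    v * v ^ (q ℕ.∸ 1)  ≈⟨ *-^[q-1] v ⟩
    v ᵠ                ≈⟨ ᵠ-+ 1ᵠ (conj-conj l) ⟩
    1# + l             ≈⟨ modulo N≈1 (solve 2 (λ l L →
              con true :+ l := (con true :+ L) :* l :+ con true :* (l :* L :+ con true)) ≡.refl l (l ᵠ)) ⟩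
    v * l              ∎)
    where
    v : Carrier
    v = 1# + l ᵠ
    v≉0 : v ≉ 0#
    v≉0 v≈0 = l≉1 (trans (sym (conj-conj l)) (trans (ᵠ-cong (sym (+≈0⇒≈ v≈0))) 1ᵠ))

  -- Here l = vᵠ / v, and v and vᵠ have the same norm.
  IsPower⇒norm-one : ∀ {l} → IsPower[q-1] l → l * l ᵠ ≈ 1#
  IsPower⇒norm-one {l} (v , v≉0 , v^≈l) = *-cancelˡ-≉0 v≉0 (begin
    v * (l * l ᵠ)  ≈⟨ *-assoc v l _ ⟨
    v * l * l ᵠ    ≈⟨ *-congʳ vl≈vᵠ ⟩
    v ᵠ * l ᵠ      ≈⟨ ᵠ-* refl refl ⟨
    (v * l) ᵠ      ≈⟨ ᵠ-cong vl≈vᵠ ⟩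
    (v ᵠ) ᵠ        ≈⟨ conj-conj v ⟩
    v              ≈⟨ *-identityʳ v ⟨
    v * 1#         ∎)
    where
    vl≈vᵠ : v * l ≈ v ᵠ
    vl≈vᵠ = trans (*-congˡ (sym v^≈l)) (*-^[q-1] v)

  -- The conjugate solves the same equation, whose only solutions are x and x + 1.
  artin-schreier-conjugate : ∀ {x k} → k ᵠ ≈ k → x * x + x ≈ k → x ᵠ ≈ x ⊎ x ᵠ ≈ x + 1#
  artin-schreier-conjugate {x} {k} kᵠ≈k x²+x≈k with (x ᵠ + x) ≟ 0#
  ... | yes xᵠ+x≈0 = inj₁ (+≈0⇒≈ xᵠ+x≈0)
  ... | no  xᵠ+x≉0 = inj₂ (modulo (*-cancelˡ-≉0 xᵠ+x≉0 idem)
      (solve 2 (λ x X → X := x :+ con true :+ con true :* (X :+ x :+ con true)) ≡.refl x (x ᵠ)))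
    where
    conj-eq : x ᵠ * x ᵠ + x ᵠ ≈ k
    conj-eq = trans (sym (ᵠ-+ (ᵠ-* refl refl) refl)) (trans (ᵠ-cong x²+x≈k) kᵠ≈k)
    idem : (x ᵠ + x) * (x ᵠ + x) ≈ (x ᵠ + x) * 1#
    idem = modulo x²+x≈k (modulo conj-eq (solve 3 (λ x X k →
      (X :+ x) :* (X :+ x) := (X :+ x) :* con true :+ con true :* (x :* x :+ x :+ k) :+ con true :* (X :* X :+ X :+ k))
      ≡.refl x (x ᵠ) k))

  -- If x xᵠ + x + h has no zero, then n² + T n + h hᵠ, where T = h + hᵠ + 1, has
  -- no zero in K (n would give the zero h + n); let n be a root of it in L.  Then
  -- x = h / (n + h) is a root of x² + T x + h, and one takes y = xᵠ + h + hᵠ.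
  conjugate-zeros : ∀ h → (∀ x → x * x ᵠ + x + h ≉ 0#) →
    ∃₂ λ x y → x * y ᵠ + x + h ≈ 0# × y * x ᵠ + y + h ≈ 0#
  conjugate-zeros h no-zero = x , y ,
    (begin
      x * y ᵠ + x + h                    ≈⟨ +-congʳ (+-congʳ (*-congˡ (ᵠ-+ (ᵠ-+ (conj-conj x) refl) (conj-conj h)))) ⟩
      x * (x + H + h) + x + h            ≈⟨ solve 3 (λ x h H →
                x :* (x :+ H :+ h) :+ x :+ h := x :* x :+ (h :+ H :+ con true) :* x :+ h) ≡.refl x h H ⟩
      x * x + T * x + h                  ≈⟨ x-root ⟩
      0#                                 ∎) ,
    (begin
      (x ᵠ + h + H) * x ᵠ + (x ᵠ + h + H) + h  ≈⟨ solve 3 (λ x h H →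
                (x :+ h :+ H) :* x :+ (x :+ h :+ H) :+ h
                := x :* x :+ (h :+ H :+ con true) :* x :+ H) ≡.refl (x ᵠ) h H ⟩
      x ᵠ * x ᵠ + T * x ᵠ + H            ≈⟨ ᵠ-+ (ᵠ-+ (ᵠ-* refl refl) (ᵠ-* T-real refl)) refl ⟨
      (x * x + T * x + h) ᵠ              ≈⟨ ᵠ-cong x-root ⟩
      0# ᵠ                               ≈⟨ 0ᵠ ⟩
      0#                                 ∎)
    where
    H T : Carrier
    H = h ᵠ
    T = h + H + 1#

    T-real : T ᵠ ≈ T
    T-real = ᵠ-+ (τ-real h) 1ᵠ

    no-real-root : ∀ {n} → n ᵠ ≈ n → n * n + T * n + h * H ≉ 0#
    no-real-root {n} nᵠ≈n eq = no-zero (h + n) (begin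
      (h + n) * (h + n) ᵠ + (h + n) + h  ≈⟨ +-congʳ (+-congʳ (*-congˡ (ᵠ-+ refl nᵠ≈n))) ⟩
      (h + n) * (H + n) + (h + n) + h    ≈⟨ solve 3 (λ h H n →
                (h :+ n) :* (H :+ n) :+ (h :+ n) :+ h
                := n :* n :+ (h :+ H :+ con true) :* n :+ h :* H) ≡.refl h H n ⟩
      n * n + T * n + h * H              ≈⟨ eq ⟩
      0#                                 ∎)

    -- For T = 0 the quadratic is n² + h hᵠ, and the square root of a norm lies in K.
    T≉0 : T ≉ 0#
    T≉0 T≈0 with n , nn≈N ← √ (h * H) = no-real-root (√-real (norm-real h) nn≈N)
      (modulo T≈0 (modulo nn≈N (solve 4 (λ n T h H → n :* n :+ T :* n :+ h :* H
        := con false :+ n :* (T :+ con false) :+ con true :* (n :* n :+ h :* H)) ≡.refl n T h H)))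

    I : Carrier
    I = proj₁ (inverse T≉0)

    TI≈1 : T * I ≈ 1#
    TI≈1 = proj₂ (inverse T≉0)

    I-real : I ᵠ ≈ I
    I-real = inverse-real T-real TI≈1

    -- The substitution n = T m turns the quadratic for n into m² + m = k.
    k : Carrier
    k = h * H * (I * I)

    k-real : k ᵠ ≈ k
    k-real = ᵠ-* (norm-real h) (ᵠ-* I-real I-real)

    m n : Carrier
    m = proj₁ (artin-schreier k k-real)
    n = T * m

    m²+m≈k : m * m + m ≈ k
    m²+m≈k = proj₂ (artin-schreier k k-real)

    n-root : n * n + T * n + h * H ≈ 0#
    n-root = modulo TI≈1 (modulo m²+m≈k (solve 5 (λ T m h H I →
      (T :* m) :* (T :* m) :+ T :* (T :* m) :+ h :* H
      := con false :+ (h :* H :* (T :* I :+ con true)) :* (T :* I :+ con true)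
         :+ (T :* T) :* (m :* m :+ m :+ h :* H :* (I :* I))) ≡.refl T m h H I))

    nᵠ≈n+T : n ᵠ ≈ n + T
    nᵠ≈n+T = [ (λ mᵠ≈m → contradiction n-root (no-real-root (ᵠ-* T-real mᵠ≈m)))
             , (λ mᵠ≈m+1 → trans (ᵠ-* T-real mᵠ≈m+1) (trans (distribˡ T m 1#) (+-congˡ (*-identityʳ T))))
             ]′ (artin-schreier-conjugate k-real m²+m≈k)

    -- If n = h, then hᵠ = nᵠ = n + T = hᵠ + 1.
    n+h≉0 : n + h ≉ 0#
    n+h≉0 n+h≈0 = 1≉0 (modulo n+h≈0 (modulo nᵠ≈n+T (modulo (ᵠ-cong (+≈0⇒≈ n+h≈0))
      (solve 4 (λ n N h H → con true := con false :+ con true :* (n :+ h :+ con false)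
         :+ con true :* (N :+ (n :+ (h :+ H :+ con true))) :+ con true :* (N :+ H)) ≡.refl n (n ᵠ) h H))))

    j x y : Carrier
    j = proj₁ (inverse n+h≉0)
    -- The equation for n makes n + h a root of X² + T X + h; the roots have product h, so `x` is
    -- the other one.
    x = h * j
    -- This is forced: the first equation and the conjugate of the second add up to x + yᵠ + h + hᵠ
    -- = 0.
    y = x ᵠ + h + H

    x-root : x * x + T * x + h ≈ 0#
    x-root = modulo n-root (modulo (proj₂ (inverse n+h≉0)) (solve 4 (λ n h H j →
      let t = h :+ H :+ con true ; u = (n :+ h) :* j :+ con true in
      (h :* j) :* (h :* j) :+ t :* (h :* j) :+ h
      := con false :+ h :* j :* j :* (n :* n :+ t :* n :+ h :* H :+ con false)
         :+ (t :* h :* j :+ h :* u) :* u) ≡.refl n h H j))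

-- Linear changes of coordinates on L × L

module Isotopies {c ℓ} (s : ℕ) (1≤s : 1 ℕ.≤ s)
  (L : CommutativeRing c ℓ) (isField : IsField L)
  (order : HasOrder (CommutativeRing.setoid L) ((2 ℕ.^ s) ℕ.^ 2)) where
  open Conjugation s 1≤s L isField order
  open import Relation.Binary.Reasoning.Setoid setoid
  open AbelianGroup L×L using () renaming (rawGroup to L²; _≈_ to _≈²_; trans to ≈²-trans)

  linear : (u v : Carrier × Carrier) → Carrier × Carrier → Carrier × Carrier
  linear (u₁ , u₂) (v₁ , v₂) (a , b) = u₁ * a + v₁ * b , u₂ * a + v₂ * b

  det : (u v : Carrier × Carrier) → Carrier
  det (u₁ , u₂) (v₁ , v₂) = u₁ * v₂ + u₂ * v₁

  -- Cramer's rule; the adjugate matrix has no signs in characteristic two.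
  linear-iso : ∀ u v → det u v ≉ 0# → IsGroupIsomorphism L² L² (linear u v)
  linear-iso u@(u₁ , u₂) v@(v₁ , v₂) D≉0 with d , Dd≈1 ← inverse D≉0 =
    additiveIso L×L (linear (v₂ * d , u₂ * d) (v₁ * d , u₁ * d)) (cong _ _) (cong _ _) homo
      (λ (a , b) →
        modulo Dd≈1 (solve 7 (λ u₁ u₂ v₁ v₂ a b d →
          u₁ :* (v₂ :* d :* a :+ v₁ :* d :* b) :+ v₁ :* (u₂ :* d :* a :+ u₁ :* d :* b)
          := a :+ a :* ((u₁ :* v₂ :+ u₂ :* v₁) :* d :+ con true)) ≡.refl u₁ u₂ v₁ v₂ a b d) ,
        modulo Dd≈1 (solve 7 (λ u₁ u₂ v₁ v₂ a b d →
          u₂ :* (v₂ :* d :* a :+ v₁ :* d :* b) :+ v₂ :* (u₂ :* d :* a :+ u₁ :* d :* b)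
          := b :+ b :* ((u₁ :* v₂ :+ u₂ :* v₁) :* d :+ con true)) ≡.refl u₁ u₂ v₁ v₂ a b d))
      (λ (a , b) →
        modulo Dd≈1 (solve 7 (λ u₁ u₂ v₁ v₂ a b d →
          v₂ :* d :* (u₁ :* a :+ v₁ :* b) :+ v₁ :* d :* (u₂ :* a :+ v₂ :* b)
          := a :+ a :* ((u₁ :* v₂ :+ u₂ :* v₁) :* d :+ con true)) ≡.refl u₁ u₂ v₁ v₂ a b d) ,
        modulo Dd≈1 (solve 7 (λ u₁ u₂ v₁ v₂ a b d →
          u₂ :* d :* (u₁ :* a :+ v₁ :* b) :+ u₁ :* d :* (u₂ :* a :+ v₂ :* b)
          := b :+ b :* ((u₁ :* v₂ :+ u₂ :* v₁) :* d :+ con true)) ≡.refl u₁ u₂ v₁ v₂ a b d))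
    where
    cong : ∀ u v {x y} → x ≈² y → linear u v x ≈² linear u v y
    cong _ _ (a≈ , b≈) = +-cong (*-congˡ a≈) (*-congˡ b≈) , +-cong (*-congˡ a≈) (*-congˡ b≈)
    homo₁ : ∀ u v a b c d → u * (a + c) + v * (b + d) ≈ (u * a + v * b) + (u * c + v * d)
    homo₁ = solve 6 (λ u v a b c d →
      u :* (a :+ c) :+ v :* (b :+ d) := (u :* a :+ v :* b) :+ (u :* c :+ v :* d)) ≡.refl
    homo : ∀ x y → linear u v (proj₁ x + proj₁ y , proj₂ x + proj₂ y) ≈²
             (proj₁ (linear u v x) + proj₁ (linear u v y) , proj₂ (linear u v x) + proj₂ (linear u v y))
    homo (a , b) (c , d) = homo₁ u₁ v₁ a b c d , homo₁ u₂ v₂ a b c d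

  diagonal : Carrier → Carrier → Carrier × Carrier → Carrier × Carrier
  diagonal k₁ k₂ (a , b) = k₁ * a , k₂ * b

  diagonal-iso : ∀ {k₁ k₂ j₁ j₂} → j₁ * k₁ ≈ 1# → j₂ * k₂ ≈ 1# →
                 IsGroupIsomorphism L² L² (diagonal k₁ k₂)
  diagonal-iso {k₁} {k₂} {j₁} {j₂} jk₁≈1 jk₂≈1 =
    additiveIso L×L (diagonal j₁ j₂)
      (λ (a≈ , b≈) → *-congˡ a≈ , *-congˡ b≈) (λ (a≈ , b≈) → *-congˡ a≈ , *-congˡ b≈)
      (λ _ _ → distribˡ _ _ _ , distribˡ _ _ _)
      (λ (a , b) → undo′ jk₁≈1 a , undo′ jk₂≈1 b) (λ (a , b) → undo jk₁≈1 a , undo jk₂≈1 b)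
    where
    undo : ∀ {j k} → j * k ≈ 1# → ∀ a → j * (k * a) ≈ a
    undo {j} {k} jk≈1 a = trans (sym (*-assoc j k a)) (trans (*-congʳ jk≈1) (*-identityˡ a))
    undo′ : ∀ {j k} → j * k ≈ 1# → ∀ a → k * (j * a) ≈ a
    undo′ jk≈1 = undo (trans (*-comm _ _) jk≈1)

  -- The sesquilinear form F and its diagonalisation

  module SesquilinearForm (p₁ p₂ p₃ p₄ : Carrier) where
    t : Vec Carrier 4
    t = p₁ ∷ p₂ ∷ p₃ ∷ p₄ ∷ []

    F : (u v : Carrier × Carrier) → Carrier
    F (a , b) (c , d) = p₁ * a * c ᵠ + p₂ * b * c ᵠ + p₃ * a * d ᵠ + p₄ * b * d ᵠ

    F-cong : ∀ {u u′ v v′} → u ≈² u′ → v ≈² v′ → F u v ≈ F u′ v′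
    F-cong (a≈ , b≈) (c≈ , d≈) =
      +-cong (+-cong (+-cong (*-cong (*-congˡ a≈) (ᵠ-cong c≈)) (*-cong (*-congˡ b≈) (ᵠ-cong c≈)))
                     (*-cong (*-congˡ a≈) (ᵠ-cong d≈))) (*-cong (*-congˡ b≈) (ᵠ-cong d≈))

    B₁≈ : ∀ l x y → proj₁ (B l t x y) ≈ F x y + l * F y x
    B₁≈ l (a , b) (c , d) = solve 13 (λ l p₁ p₂ p₃ p₄ a b c d A B C D →
        p₁ :* a :* C :+ l :* p₁ :* A :* c :+ p₂ :* b :* C :+ l :* p₂ :* A :* d
        :+ p₃ :* a :* D :+ l :* p₃ :* B :* c :+ p₄ :* b :* D :+ l :* p₄ :* B :* d
        := (p₁ :* a :* C :+ p₂ :* b :* C :+ p₃ :* a :* D :+ p₄ :* b :* D)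
           :+ l :* (p₁ :* c :* A :+ p₂ :* d :* A :+ p₃ :* c :* B :+ p₄ :* d :* B))
      ≡.refl l p₁ p₂ p₃ p₄ a b c d (a ᵠ) (b ᵠ) (c ᵠ) (d ᵠ)

    F-linearˡ : ∀ u v a b w → F (linear u v (a , b)) w ≈ a * F u w + b * F v w
    F-linearˡ (u₁ , u₂) (v₁ , v₂) a b (w₁ , w₂) = solve 12 (λ p₁ p₂ p₃ p₄ u₁ u₂ v₁ v₂ a b W₁ W₂ →
        p₁ :* (u₁ :* a :+ v₁ :* b) :* W₁ :+ p₂ :* (u₂ :* a :+ v₂ :* b) :* W₁
        :+ p₃ :* (u₁ :* a :+ v₁ :* b) :* W₂ :+ p₄ :* (u₂ :* a :+ v₂ :* b) :* W₂
        := a :* (p₁ :* u₁ :* W₁ :+ p₂ :* u₂ :* W₁ :+ p₃ :* u₁ :* W₂ :+ p₄ :* u₂ :* W₂)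
           :+ b :* (p₁ :* v₁ :* W₁ :+ p₂ :* v₂ :* W₁ :+ p₃ :* v₁ :* W₂ :+ p₄ :* v₂ :* W₂))
      ≡.refl p₁ p₂ p₃ p₄ u₁ u₂ v₁ v₂ a b (w₁ ᵠ) (w₂ ᵠ)

    F-linearʳ : ∀ w u v a b → F w (linear u v (a , b)) ≈ a ᵠ * F w u + b ᵠ * F w v
    F-linearʳ (w₁ , w₂) (u₁ , u₂) (v₁ , v₂) a b = begin
      F (w₁ , w₂) (linear (u₁ , u₂) (v₁ , v₂) (a , b))
        ≈⟨ +-cong (+-cong (+-cong (*-congˡ (conj u₁ v₁)) (*-congˡ (conj u₁ v₁))) (*-congˡ (conj u₂ v₂))) (*-congˡ (conj u₂ v₂)) ⟩
      p₁ * w₁ * (u₁ ᵠ * a ᵠ + v₁ ᵠ * b ᵠ) + p₂ * w₂ * (u₁ ᵠ * a ᵠ + v₁ ᵠ * b ᵠ)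
        + p₃ * w₁ * (u₂ ᵠ * a ᵠ + v₂ ᵠ * b ᵠ) + p₄ * w₂ * (u₂ ᵠ * a ᵠ + v₂ ᵠ * b ᵠ)
        ≈⟨ solve 12 (λ p₁ p₂ p₃ p₄ w₁ w₂ U₁ U₂ V₁ V₂ A B →
             p₁ :* w₁ :* (U₁ :* A :+ V₁ :* B) :+ p₂ :* w₂ :* (U₁ :* A :+ V₁ :* B)
             :+ p₃ :* w₁ :* (U₂ :* A :+ V₂ :* B) :+ p₄ :* w₂ :* (U₂ :* A :+ V₂ :* B)
             := A :* (p₁ :* w₁ :* U₁ :+ p₂ :* w₂ :* U₁ :+ p₃ :* w₁ :* U₂ :+ p₄ :* w₂ :* U₂)
                :+ B :* (p₁ :* w₁ :* V₁ :+ p₂ :* w₂ :* V₁ :+ p₃ :* w₁ :* V₂ :+ p₄ :* w₂ :* V₂))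
             ≡.refl p₁ p₂ p₃ p₄ w₁ w₂ (u₁ ᵠ) (u₂ ᵠ) (v₁ ᵠ) (v₂ ᵠ) (a ᵠ) (b ᵠ) ⟩
      a ᵠ * F (w₁ , w₂) (u₁ , u₂) + b ᵠ * F (w₁ , w₂) (v₁ , v₂)  ∎
      where
      conj : ∀ u v → (u * a + v * b) ᵠ ≈ u ᵠ * a ᵠ + v ᵠ * b ᵠ
      conj u v = ᵠ-+ (ᵠ-* refl refl) (ᵠ-* refl refl)

    F-diagonal : ∀ {u v} → F u v ≈ 0# → F v u ≈ 0# → ∀ a b c d →
                 F (linear u v (a , b)) (linear u v (c , d)) ≈ a * c ᵠ * F u u + b * d ᵠ * F v v
    F-diagonal {u} {v} uv≈0 vu≈0 a b c d = begin
      F (linear u v (a , b)) w             ≈⟨ F-linearˡ u v a b w ⟩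
      a * F u w + b * F v w                ≈⟨ +-cong (*-congˡ (F-linearʳ u u v c d)) (*-congˡ (F-linearʳ v u v c d)) ⟩
      a * (c ᵠ * F u u + d ᵠ * F u v) + b * (c ᵠ * F v u + d ᵠ * F v v)
        ≈⟨ modulo uv≈0 (modulo vu≈0 (solve 8 (λ a b C D uu uv vu vv →
             a :* (C :* uu :+ D :* uv) :+ b :* (C :* vu :+ D :* vv)
             := a :* C :* uu :+ b :* D :* vv :+ a :* D :* (uv :+ con false) :+ b :* C :* (vu :+ con false))
             ≡.refl a b (c ᵠ) (d ᵠ) (F u u) (F u v) (F v u) (F v v))) ⟩
      a * c ᵠ * F u u + b * d ᵠ * F v v    ∎
      where
      w : Carrier × Carrier
      w = linear u v (c , d)

    F-scaleˡ : ∀ ρ u v → F (diagonal ρ ρ u) v ≈ ρ * F u v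
    F-scaleˡ ρ (u₁ , u₂) (v₁ , v₂) = solve 9 (λ p₁ p₂ p₃ p₄ ρ u₁ u₂ V₁ V₂ →
      p₁ :* (ρ :* u₁) :* V₁ :+ p₂ :* (ρ :* u₂) :* V₁ :+ p₃ :* (ρ :* u₁) :* V₂ :+ p₄ :* (ρ :* u₂) :* V₂
      := ρ :* (p₁ :* u₁ :* V₁ :+ p₂ :* u₂ :* V₁ :+ p₃ :* u₁ :* V₂ :+ p₄ :* u₂ :* V₂))
      ≡.refl p₁ p₂ p₃ p₄ ρ u₁ u₂ (v₁ ᵠ) (v₂ ᵠ)

    F-scaleʳ : ∀ ρ u v → F u (diagonal ρ ρ v) ≈ ρ ᵠ * F u v
    F-scaleʳ ρ (u₁ , u₂) (v₁ , v₂) = begin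
      F (u₁ , u₂) (ρ * v₁ , ρ * v₂)
        ≈⟨ +-cong (+-cong (+-cong (*-congˡ (ᵠ-* refl refl)) (*-congˡ (ᵠ-* refl refl))) (*-congˡ (ᵠ-* refl refl))) (*-congˡ (ᵠ-* refl refl)) ⟩
      p₁ * u₁ * (ρ ᵠ * v₁ ᵠ) + p₂ * u₂ * (ρ ᵠ * v₁ ᵠ) + p₃ * u₁ * (ρ ᵠ * v₂ ᵠ) + p₄ * u₂ * (ρ ᵠ * v₂ ᵠ)
        ≈⟨ solve 9 (λ p₁ p₂ p₃ p₄ ρ u₁ u₂ V₁ V₂ →
             p₁ :* u₁ :* (ρ :* V₁) :+ p₂ :* u₂ :* (ρ :* V₁) :+ p₃ :* u₁ :* (ρ :* V₂) :+ p₄ :* u₂ :* (ρ :* V₂)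
             := ρ :* (p₁ :* u₁ :* V₁ :+ p₂ :* u₂ :* V₁ :+ p₃ :* u₁ :* V₂ :+ p₄ :* u₂ :* V₂))
             ≡.refl p₁ p₂ p₃ p₄ (ρ ᵠ) u₁ u₂ (v₁ ᵠ) (v₂ ᵠ) ⟩
      ρ ᵠ * F (u₁ , u₂) (v₁ , v₂)  ∎

    -- Scaling one factor by ζ multiplies F (x , y) + l F (y , x) by ζ and l by
    -- ζᵠ / ζ, which takes l = ζ² to the norm of ζ.
    diagonalise : ∀ {l ζ μ u v} → ζ * ζ ≈ l → ζ ≉ 0# → F u u ≉ 0# → det u v ≉ 0# →
                  F u v ≈ 0# → F v u ≈ 0# → F v v ≈ F u u * μ →
                  Isotopic L×L (B l t) (B (ζ * ζ ᵠ) (1# ∷ 0# ∷ 0# ∷ μ ∷ []))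
    diagonalise {l} {ζ} {μ} {u@(u₁ , u₂)} {v@(v₁ , v₂)} ζζ≈l ζ≉0 p≉0 D≉0 uv≈0 vu≈0 vv≈pμ = record
      { α₁ = linear u v ∘ diagonal ζ ζ
      ; α₂ = linear u v
      ; β  = diagonal k₁ k₂
      ; α₁-isIsomorphism = Composition.isGroupIsomorphism ≈²-trans
          (diagonal-iso (trans (*-comm _ _) ζi≈1) (trans (*-comm _ _) ζi≈1)) (linear-iso u v D≉0)
      ; α₂-isIsomorphism = linear-iso u v D≉0
      ; β-isIsomorphism  = diagonal-iso ζpk≈1 ζDk≈1
      ; isotopy = λ (a , b) (c , d) → first a b c d , second a b c d
      }
      where
      p : Carrier
      p = F u u
      -- In the new coordinates the first component carries the factor ζ F(u, u), and the second,
      -- being a determinant, the factor ζ det(u, v); `k₁` and `k₂` remove them.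
      i k₁ k₂ : Carrier
      i = proj₁ (inverse ζ≉0)
      k₁ = proj₁ (inverse (*-≉0 ζ≉0 p≉0))
      k₂ = proj₁ (inverse (*-≉0 ζ≉0 D≉0))
      ζi≈1 : ζ * i ≈ 1#
      ζi≈1 = proj₂ (inverse ζ≉0)
      ζpk≈1 : ζ * p * k₁ ≈ 1#
      ζpk≈1 = proj₂ (inverse (*-≉0 ζ≉0 p≉0))
      ζDk≈1 : ζ * det u v * k₂ ≈ 1#
      ζDk≈1 = proj₂ (inverse (*-≉0 ζ≉0 D≉0))

      second : ∀ a b c d → k₂ * ((u₁ * (ζ * a) + v₁ * (ζ * b)) * (u₂ * c + v₂ * d)
                                + (u₂ * (ζ * a) + v₂ * (ζ * b)) * (u₁ * c + v₁ * d)) ≈ a * d + b * c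
      second a b c d = modulo ζDk≈1 (solve 10 (λ u₁ u₂ v₁ v₂ a b c d ζ k →
        k :* ((u₁ :* (ζ :* a) :+ v₁ :* (ζ :* b)) :* (u₂ :* c :+ v₂ :* d)
              :+ (u₂ :* (ζ :* a) :+ v₂ :* (ζ :* b)) :* (u₁ :* c :+ v₁ :* d))
        := a :* d :+ b :* c :+ (a :* d :+ b :* c) :* (ζ :* (u₁ :* v₂ :+ u₂ :* v₁) :* k :+ con true))
        ≡.refl u₁ u₂ v₁ v₂ a b c d ζ k₂)

      first : ∀ a b c d → k₁ * proj₁ (B l t (linear u v (ζ * a , ζ * b)) (linear u v (c , d)))
                        ≈ proj₁ (B (ζ * ζ ᵠ) (1# ∷ 0# ∷ 0# ∷ μ ∷ []) (a , b) (c , d))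
      first a b c d = begin
        k₁ * proj₁ (B l t x y)             ≈⟨ *-congˡ (B₁≈ l x y) ⟩
        k₁ * (F x y + l * F y x)           ≈⟨ *-congˡ (+-cong (F-diagonal uv≈0 vu≈0 _ _ _ _)
                                               (*-congˡ (trans (F-diagonal uv≈0 vu≈0 _ _ _ _)
                                                 (+-cong (*-congʳ (*-congˡ (ᵠ-* refl refl))) (*-congʳ (*-congˡ (ᵠ-* refl refl))))))) ⟩
        k₁ * ((ζ * a) * c ᵠ * p + (ζ * b) * d ᵠ * F v v
              + l * (c * (ζ ᵠ * a ᵠ) * p + d * (ζ ᵠ * b ᵠ) * F v v))
          ≈⟨ modulo ζζ≈l (modulo vv≈pμ (modulo ζpk≈1 (solve 15 (λ a b c d A B C D k ζ Z l p r μ →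
               let E = con true :* a :* C :+ ζ :* Z :* con true :* A :* c :+ con false :* b :* C
                       :+ ζ :* Z :* con false :* A :* d :+ con false :* a :* D
                       :+ ζ :* Z :* con false :* B :* c :+ μ :* b :* D :+ ζ :* Z :* μ :* B :* d in
               k :* ((ζ :* a) :* C :* p :+ (ζ :* b) :* D :* r
                     :+ l :* (c :* (Z :* A) :* p :+ d :* (Z :* B) :* r))
               := E :+ k :* (c :* (Z :* A) :* p :+ d :* (Z :* B) :* r) :* (ζ :* ζ :+ l)
                  :+ k :* (ζ :* b :* D :+ ζ :* ζ :* d :* Z :* B) :* (r :+ p :* μ)
                  :+ E :* (ζ :* p :* k :+ con true))
               ≡.refl a b c d (a ᵠ) (b ᵠ) (c ᵠ) (d ᵠ) k₁ ζ (ζ ᵠ) l p (F v v) μ))) ⟩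
        proj₁ (B (ζ * ζ ᵠ) (1# ∷ 0# ∷ 0# ∷ μ ∷ []) (a , b) (c , d))  ∎
        where
        x y : Carrier × Carrier
        x = linear u v (ζ * a , ζ * b)
        y = linear u v (c , d)

    module _ (legitimate : Legitimate t) where
      private
        p₁≉0 : p₁ ≉ 0#
        p₁≉0 = proj₁ legitimate

        no-zero : ∀ x → p₁ * (x ᵠ * x) + p₂ * x ᵠ + p₃ * x + p₄ ≉ 0#
        no-zero x eq = proj₂ legitimate x
          (trans (+-congʳ (+-congʳ (+-congʳ (*-congˡ (trans (^-homo-* x q 1) (*-congˡ (*-identityʳ x))))))) eq)

      -- If b ≠ 0, dividing F(w, w) by b bᵠ gives the polynomial of t at a / b; if b = 0, only p₁ a
      -- aᵠ remains.
      anisotropic : ∀ {w} → F w w ≈ 0# → w ≈² (0# , 0#)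
      anisotropic {a , b} Fww≈0 with b ≟ 0# | a ≟ 0#
      ... | yes b≈0 | yes a≈0 = a≈0 , b≈0
      ... | yes b≈0 | no  a≉0 = contradiction
        (modulo Fww≈0 (modulo b≈0 (modulo (trans (ᵠ-cong b≈0) 0ᵠ) (solve 8 (λ p₁ p₂ p₃ p₄ a b A B →
          p₁ :* a :* A := con false :+ con true :* (p₁ :* a :* A :+ p₂ :* b :* A :+ p₃ :* a :* B :+ p₄ :* b :* B :+ con false)
            :+ (p₂ :* A :+ p₄ :* B) :* (b :+ con false) :+ p₃ :* a :* (B :+ con false))
          ≡.refl p₁ p₂ p₃ p₄ a b (a ᵠ) (b ᵠ)))))
        (*-≉0 (*-≉0 p₁≉0 a≉0) (ᵠ-≉0 a≉0))
      ... | no  b≉0 | _ with i , bi≈1 ← inverse b≉0 = contradiction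
        (begin
          p₁ * ((a * i) ᵠ * (a * i)) + p₂ * (a * i) ᵠ + p₃ * (a * i) + p₄
            ≈⟨ +-congʳ (+-congʳ (+-cong (*-congˡ (*-congʳ (ᵠ-* refl refl))) (*-congˡ (ᵠ-* refl refl)))) ⟩
          p₁ * ((a ᵠ * i ᵠ) * (a * i)) + p₂ * (a ᵠ * i ᵠ) + p₃ * (a * i) + p₄
            ≈⟨ modulo Fww≈0 (modulo bi≈1 (modulo (trans (sym (ᵠ-* refl refl)) (trans (ᵠ-cong bi≈1) 1ᵠ))
                 (solve 10 (λ p₁ p₂ p₃ p₄ a b A B i I →
                   p₁ :* ((A :* I) :* (a :* i)) :+ p₂ :* (A :* I) :+ p₃ :* (a :* i) :+ p₄
                   := con false :+ i :* I :* (p₁ :* a :* A :+ p₂ :* b :* A :+ p₃ :* a :* B :+ p₄ :* b :* B :+ con false)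
                      :+ (p₂ :* A :* I :+ p₄) :* (b :* i :+ con true)
                      :+ (p₃ :* a :* i :+ p₄ :* i :* b) :* (B :* I :+ con true))
                   ≡.refl p₁ p₂ p₃ p₄ a b (a ᵠ) (b ᵠ) i (i ᵠ)))) ⟩
          0#  ∎)
        (no-zero (a * i))

      -- If the determinant vanishes, then vᵢ u = uᵢ v for both coordinates. Pairing with u gives
      -- vᵢᵠ F(u, u) = uᵢᵠ F(u, v) = 0, so v = 0.
      orthogonal⇒det≉0 : ∀ {u v} → F u u ≉ 0# → F v v ≉ 0# → F u v ≈ 0# → det u v ≉ 0#
      orthogonal⇒det≉0 {u@(u₁ , u₂)} {v@(v₁ , v₂)} uu≉0 vv≉0 uv≈0 D≈0 =
        vv≉0 (trans (F-cong v≈0 v≈0) F0≈0)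
        where
        F0≈0 : F (0# , 0#) (0# , 0#) ≈ 0#
        F0≈0 = solve 5 (λ p₁ p₂ p₃ p₄ z →
          p₁ :* con false :* z :+ p₂ :* con false :* z :+ p₃ :* con false :* z :+ p₄ :* con false :* z
          := con false) ≡.refl p₁ p₂ p₃ p₄ (0# ᵠ)
        zero-coordinate : ∀ vᵢ uᵢ → diagonal vᵢ vᵢ u ≈² diagonal uᵢ uᵢ v → vᵢ ≈ 0#
        zero-coordinate vᵢ uᵢ eq with vᵢ ≟ 0#
        ... | yes vᵢ≈0 = vᵢ≈0
        ... | no  vᵢ≉0 = contradiction (begin
          vᵢ ᵠ * F u u              ≈⟨ F-scaleʳ vᵢ u u ⟨
          F u (diagonal vᵢ vᵢ u)    ≈⟨ F-cong (refl , refl) eq ⟩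
          F u (diagonal uᵢ uᵢ v)    ≈⟨ F-scaleʳ uᵢ u v ⟩
          uᵢ ᵠ * F u v              ≈⟨ *-congˡ uv≈0 ⟩
          uᵢ ᵠ * 0#                 ≈⟨ zeroʳ _ ⟩
          0#                        ∎) (*-≉0 (ᵠ-≉0 vᵢ≉0) uu≉0)
        v≈0 : v ≈² (0# , 0#)
        v≈0 = zero-coordinate v₁ u₁ (*-comm v₁ u₁ , trans (*-comm v₁ u₂) (sym (+≈0⇒≈ D≈0)))
            , zero-coordinate v₂ u₂ (trans (*-comm v₂ u₁) (+≈0⇒≈ D≈0) , *-comm v₂ u₂)

      -- With e = p₂ / p₁ and g = eᵠ + p₃ / p₁, the form vanishes at
      -- ((X , 1) , (Y , 1)), where X = e + gᵠ x and Y = e + gᵠ y, if and only if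
      -- x yᵠ + x + h = 0.
      orthogonal-basis : ∃₂ λ u v → F u u ≉ 0# × F v v ≉ 0# × F u v ≈ 0# × F v u ≈ 0#
      orthogonal-basis = basis (g ≟ 0#)
        where
        -- `e` is chosen so that F((e, 1), (1, 0)) = 0, and p₁ g is F((1, 0), (e, 1)). Shifting by e
        -- thus removes the term in yᵠ alone, and scaling by gᵠ gives x yᵠ and x the same
        -- coefficient.
        i e g : Carrier
        i = proj₁ (inverse p₁≉0)
        e = p₂ * i
        g = e ᵠ + p₃ * i

        p₁i≈1 : p₁ * i ≈ 1#
        p₁i≈1 = proj₂ (inverse p₁≉0)

        nonzero : ∀ x → F (x , 1#) (x , 1#) ≉ 0#
        nonzero x Fxx≈0 = 1≉0 (proj₂ (anisotropic Fxx≈0))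

        module _ (g≉0 : g ≉ 0#) where
          -- `h` is the value F((e, 1), (e, 1)) divided by that common coefficient.
          j h : Carrier
          j = proj₁ (inverse (*-≉0 p₁≉0 (*-≉0 g≉0 (ᵠ-≉0 g≉0))))
          h = (p₁ * e * e ᵠ + p₂ * e ᵠ + p₃ * e + p₄) * j

          pgg : Carrier
          pgg = p₁ * (g * g ᵠ)

          j-inverse : pgg * j ≈ 1#
          j-inverse = proj₂ (inverse (*-≉0 p₁≉0 (*-≉0 g≉0 (ᵠ-≉0 g≉0))))

          point : Carrier → Carrier × Carrier
          point x = e + g ᵠ * x , 1#

          F-point : ∀ x y → F (point x) (point y) ≈ pgg * (x * y ᵠ + x + h)
          F-point x y = begin
            p₁ * (e + g ᵠ * x) * (e + g ᵠ * y) ᵠ + p₂ * 1# * (e + g ᵠ * y) ᵠ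
              + p₃ * (e + g ᵠ * x) * 1# ᵠ + p₄ * 1# * 1# ᵠ
              ≈⟨ +-cong (+-cong (+-cong (*-congˡ conj) (*-congˡ conj)) (*-congˡ 1ᵠ)) (*-congˡ 1ᵠ) ⟩
            p₁ * (e + g ᵠ * x) * (e ᵠ + g * y ᵠ) + p₂ * 1# * (e ᵠ + g * y ᵠ)
              + p₃ * (e + g ᵠ * x) * 1# + p₄ * 1# * 1#
              ≈⟨ modulo j-inverse (modulo p₁i≈1 (modulo p₁i≈1 (solve 10 (λ p₁ p₂ p₃ p₄ i j x Y E G →
                   let e = p₂ :* i ; g = E :+ p₃ :* i ; d = p₁ :* e :* E :+ p₂ :* E :+ p₃ :* e :+ p₄ in
                   p₁ :* (e :+ G :* x) :* (E :+ g :* Y) :+ p₂ :* con true :* (E :+ g :* Y)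
                     :+ p₃ :* (e :+ G :* x) :* con true :+ p₄ :* con true :* con true
                   := p₁ :* (g :* G) :* (x :* Y :+ x :+ d :* j)
                      :+ d :* (p₁ :* (g :* G) :* j :+ con true)
                      :+ p₂ :* g :* Y :* (p₁ :* i :+ con true)
                      :+ p₃ :* G :* x :* (p₁ :* i :+ con true))
                   ≡.refl p₁ p₂ p₃ p₄ i j x (y ᵠ) (e ᵠ) (g ᵠ)))) ⟩
            pgg * (x * y ᵠ + x + h)  ∎
            where
            conj : (e + g ᵠ * y) ᵠ ≈ e ᵠ + g * y ᵠ
            conj = ᵠ-+ refl (ᵠ-* (conj-conj g) refl)

          vanishing : ∀ x y → x * y ᵠ + x + h ≈ 0# → F (point x) (point y) ≈ 0#
          vanishing x y eq = trans (F-point x y) (trans (*-congˡ eq) (zeroʳ _))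

        basis : Dec (g ≈ 0#) → ∃₂ λ u v → F u u ≉ 0# × F v v ≉ 0# × F u v ≈ 0# × F v u ≈ 0#
        -- If g = 0, both mixed values of F at these two vectors already vanish.
        basis (yes g≈0) = (1# , 0#) , (e , 1#) ,
          (λ F≈0 → 1≉0 (proj₁ (anisotropic F≈0))) , nonzero e ,
          (begin
            p₁ * 1# * e ᵠ + p₂ * 0# * e ᵠ + p₃ * 1# * 1# ᵠ + p₄ * 0# * 1# ᵠ
              ≈⟨ modulo g≈0 (modulo 1ᵠ (modulo p₁i≈1 (solve 7 (λ p₁ p₂ p₃ p₄ i E O →
                   p₁ :* con true :* E :+ p₂ :* con false :* E :+ p₃ :* con true :* O :+ p₄ :* con false :* O
                   := con false :+ p₁ :* (E :+ p₃ :* i :+ con false) :+ p₃ :* (O :+ con true)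
                      :+ p₃ :* (p₁ :* i :+ con true))
                   ≡.refl p₁ p₂ p₃ p₄ i (e ᵠ) (1# ᵠ)))) ⟩
            0#  ∎) ,
          (begin
            p₁ * e * 1# ᵠ + p₂ * 1# * 1# ᵠ + p₃ * e * 0# ᵠ + p₄ * 1# * 0# ᵠ
              ≈⟨ modulo 0ᵠ (modulo p₁i≈1 (solve 7 (λ p₁ p₂ p₃ p₄ i O Z →
                   p₁ :* (p₂ :* i) :* O :+ p₂ :* con true :* O :+ p₃ :* (p₂ :* i) :* Z :+ p₄ :* con true :* Z
                   := con false :+ (p₃ :* p₂ :* i :+ p₄) :* (Z :+ con false)
                      :+ p₂ :* O :* (p₁ :* i :+ con true))
                   ≡.refl p₁ p₂ p₃ p₄ i (1# ᵠ) (0# ᵠ))) ⟩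
            0#  ∎)
        basis (no g≉0) =
          -- A zero with x = y would be an isotropic vector.
          let x , y , xy , yx = conjugate-zeros (h g≉0) λ x eq →
                nonzero (e + g ᵠ * x) (vanishing g≉0 x x eq)
          in point g≉0 x , point g≉0 y , nonzero _ , nonzero _ , vanishing g≉0 x y xy , vanishing g≉0 y x yx

      -- If τ(μ) = 0, then μ lies in K and so does its square root ρ. The vector ρu + v is then
      -- isotropic, hence zero, although u and v are independent.
      orthogonal⇒τ≉0 : ∀ {u v μ} → F u u ≉ 0# → F v v ≉ 0# → F u v ≈ 0# → F v u ≈ 0# →
                       F v v ≈ F u u * μ → τ μ ≉ 0#
      orthogonal⇒τ≉0 {u} {v} {μ} uu≉0 vv≉0 uv≈0 vu≈0 vv≈ τμ≈0 with ρ , ρρ≈μ ← √ μ =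
        orthogonal⇒det≉0 uu≉0 vv≉0 uv≈0 (modulo (proj₁ w≈0) (modulo (proj₂ w≈0)
          (solve 5 (λ u₁ u₂ v₁ v₂ ρ → u₁ :* v₂ :+ u₂ :* v₁
            := con false :+ u₂ :* (u₁ :* ρ :+ v₁ :* con true :+ con false)
               :+ u₁ :* (u₂ :* ρ :+ v₂ :* con true :+ con false))
          ≡.refl (proj₁ u) (proj₂ u) (proj₁ v) (proj₂ v) ρ)))
        where
        ρᵠ≈ρ : ρ ᵠ ≈ ρ
        ρᵠ≈ρ = √-real (sym (+≈0⇒≈ τμ≈0)) ρρ≈μ
        w≈0 : linear u v (ρ , 1#) ≈² (0# , 0#)
        w≈0 = anisotropic (begin
          F (linear u v (ρ , 1#)) (linear u v (ρ , 1#))  ≈⟨ F-diagonal uv≈0 vu≈0 ρ 1# ρ 1# ⟩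
          ρ * ρ ᵠ * F u u + 1# * 1# ᵠ * F v v
            ≈⟨ +-cong (*-congʳ (trans (*-congˡ ρᵠ≈ρ) ρρ≈μ)) (*-cong (*-congˡ 1ᵠ) vv≈) ⟩
          μ * F u u + 1# * 1# * (F u u * μ)
            ≈⟨ solve 2 (λ p μ → μ :* p :+ con true :* con true :* (p :* μ) := con false) ≡.refl (F u u) μ ⟩
          0#  ∎)

  -- Isotopy between the diagonal form and B_q(w)

  conjugate₁ : Carrier × Carrier → Carrier × Carrier
  conjugate₁ (a , b) = a ᵠ , b

  conjugate₁-iso : IsGroupIsomorphism L² L² conjugate₁
  conjugate₁-iso = additiveIso L×L conjugate₁ cong cong (λ _ _ → ᵠ-+ refl refl , refl) involutive involutive
    where
    cong : ∀ {x y} → x ≈² y → conjugate₁ x ≈² conjugate₁ y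
    cong (a≈ , b≈) = ᵠ-cong a≈ , b≈
    involutive : ∀ x → conjugate₁ (conjugate₁ x) ≈² x
    involutive (a , b) = conj-conj a , refl

  module DiagonalForm {x m μ w : Carrier}
    (xᵠ≈x : x ᵠ ≈ x) (mᵠ≈m : m ᵠ ≈ m) (mx≈1+x : m * x ≈ 1# + x)
    ([x²+x]τμ≈1 : (x * x + x) * τ μ ≈ 1#) (w≈ : w ≈ μ + x * x * τ μ) where

    -- Let z be the first component of the diagonal product with a replaced by aᵠ. In zᵠ + m z the
    -- terms in aᵠcᵠ cancel and ac gets the coefficient 1 + m² = 1/x², whence the factor x². After
    -- it, b dᵠ has coefficient x² m τ(μ) = (x² + x) τ(μ) = 1, and bᵠ d has x² (μᵠ + m² μ) = μ + x²
    -- τ(μ) = w.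
    β γ : Carrier × Carrier → Carrier × Carrier
    β (z , y) = x * x * (z ᵠ + m * z) , y
    γ (z , y) = z ᵠ + m * z , y

    private
      β-cong : ∀ {u v} → u ≈² v → β u ≈² β v
      β-cong (z≈ , y≈) = *-congˡ (+-cong (ᵠ-cong z≈) (*-congˡ z≈)) , y≈

      γ-cong : ∀ {u v} → u ≈² v → γ u ≈² γ v
      γ-cong (z≈ , y≈) = +-cong (ᵠ-cong z≈) (*-congˡ z≈) , y≈

      γ-+ : ∀ z z′ → (z + z′) ᵠ + m * (z + z′) ≈ (z ᵠ + m * z) + (z′ ᵠ + m * z′)
      γ-+ z z′ = trans (+-congʳ (ᵠ-+ refl refl))
        (solve 5 (λ m z z′ Z Z′ → (Z :+ Z′) :+ m :* (z :+ z′) := (Z :+ m :* z) :+ (Z′ :+ m :* z′))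
          ≡.refl m z z′ (z ᵠ) (z′ ᵠ))

      -- As m lies in K, applying z ↦ zᵠ + m z twice multiplies z by 1 + m² = 1/x².
      βγ : ∀ u → β (γ u) ≈² u
      βγ (z , y) = (begin
        x * x * ((z ᵠ + m * z) ᵠ + m * (z ᵠ + m * z))
          ≈⟨ *-congˡ (+-congʳ (ᵠ-+ (conj-conj z) (ᵠ-* mᵠ≈m refl))) ⟩
        x * x * ((z + m * z ᵠ) + m * (z ᵠ + m * z))
          ≈⟨ modulo mx≈1+x (solve 4 (λ x m z Z → x :* x :* ((z :+ m :* Z) :+ m :* (Z :+ m :* z))
               := z :+ z :* (m :* x :+ con true :+ x) :* (m :* x :+ (con true :+ x))) ≡.refl x m z (z ᵠ)) ⟩
        z  ∎) , refl

      γβ : ∀ u → γ (β u) ≈² u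
      γβ (z , y) = (begin
        (x * x * (z ᵠ + m * z)) ᵠ + m * (x * x * (z ᵠ + m * z))
          ≈⟨ +-congʳ (ᵠ-* (ᵠ-* xᵠ≈x xᵠ≈x) (ᵠ-+ (conj-conj z) (ᵠ-* mᵠ≈m refl))) ⟩
        x * x * (z + m * z ᵠ) + m * (x * x * (z ᵠ + m * z))
          ≈⟨ modulo mx≈1+x (solve 4 (λ x m z Z → x :* x :* (z :+ m :* Z) :+ m :* (x :* x :* (Z :+ m :* z))
               := z :+ z :* (m :* x :+ con true :+ x) :* (m :* x :+ (con true :+ x))) ≡.refl x m z (z ᵠ)) ⟩
        z  ∎) , refl

      diag : Vec Carrier 4
      diag = 1# ∷ 0# ∷ 0# ∷ μ ∷ []

    B→Bq : Isotopic L×L (B m diag) (Bq w)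
    B→Bq = record
      { α₁ = conjugate₁ ; α₂ = λ u → u ; β = β
      ; α₁-isIsomorphism = conjugate₁-iso
      ; α₂-isIsomorphism = additiveIso L×L (λ u → u) (λ eq → eq) (λ eq → eq)
                             (λ _ _ → refl , refl) (λ _ → refl , refl) (λ _ → refl , refl)
      ; β-isIsomorphism = additiveIso L×L γ β-cong γ-cong
          (λ (z , _) (z′ , _) → trans (*-congˡ (γ-+ z z′)) (distribˡ _ _ _) , refl) βγ γβ
      ; isotopy = λ (a , b) (c , d) → first a b c d , refl
      }
      where
      first : ∀ a b c d → proj₁ (β (B m diag (a ᵠ , b) (c , d))) ≈ a * c + b * d ᵠ + w * b ᵠ * d
      first a b c d = begin
        x * x * (E ᵠ + m * E)
          ≈⟨ *-congˡ (+-cong (trans (ᵠ-cong E≈) (ᵠ-+ (ᵠ-+ (ᵠ-+ (ᵠ-* (conj-conj a) (conj-conj c)) (ᵠ-* (ᵠ-* mᵠ≈m refl) refl))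
                (ᵠ-* (ᵠ-* refl refl) (conj-conj d))) (ᵠ-* (ᵠ-* (ᵠ-* mᵠ≈m refl) (conj-conj b)) refl))) (*-congˡ E≈)) ⟩
        x * x * ((a * c + m * a ᵠ * c ᵠ + μ ᵠ * b ᵠ * d + m * μ ᵠ * b * d ᵠ)
                 + m * (a ᵠ * c ᵠ + m * a * c + μ * b * d ᵠ + m * μ * b ᵠ * d))
          ≈⟨ modulo w≈ (modulo [x²+x]τμ≈1 (modulo mx≈1+x (solve 13 (λ a b c d A B C D x m μ M w →
               let r = m :* x :+ con true :+ x in
               x :* x :* ((a :* c :+ m :* A :* C :+ M :* B :* d :+ m :* M :* b :* D)
                 :+ m :* (A :* C :+ m :* a :* c :+ μ :* b :* D :+ m :* μ :* B :* d))
               := a :* c :+ b :* D :+ w :* B :* d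
                  :+ B :* d :* (w :+ (μ :+ x :* x :* (μ :+ M)))
                  :+ b :* D :* ((x :* x :+ x) :* (μ :+ M) :+ con true)
                  :+ (a :* c :* r :+ B :* d :* μ :* r :+ x :* b :* D :* (μ :+ M)) :* (m :* x :+ (con true :+ x)))
               ≡.refl a b c d (a ᵠ) (b ᵠ) (c ᵠ) (d ᵠ) x m μ (μ ᵠ) w))) ⟩
        a * c + b * d ᵠ + w * b ᵠ * d  ∎
        where
        E : Carrier
        E = proj₁ (B m diag (a ᵠ , b) (c , d))
        E≈ : E ≈ a ᵠ * c ᵠ + m * a * c + μ * b * d ᵠ + m * μ * b ᵠ * d
        E≈ = modulo (conj-conj a) (solve 11 (λ b c d A A′ B C D m μ a →
          con true :* A :* C :+ m :* con true :* A′ :* c :+ con false :* b :* C :+ m :* con false :* A′ :* d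
          :+ con false :* A :* D :+ m :* con false :* B :* c :+ μ :* b :* D :+ m :* μ :* B :* d
          := A :* C :+ m :* a :* c :+ μ :* b :* D :+ m :* μ :* B :* d :+ m :* c :* (A′ :+ a))
          ≡.refl b c d (a ᵠ) ((a ᵠ) ᵠ) (b ᵠ) (c ᵠ) (d ᵠ) m μ a)

    Bq→B : Isotopic L×L (Bq w) (B m diag)
    Bq→B = record
      { α₁ = conjugate₁ ; α₂ = λ u → u ; β = γ
      ; α₁-isIsomorphism = conjugate₁-iso
      ; α₂-isIsomorphism = additiveIso L×L (λ u → u) (λ eq → eq) (λ eq → eq)
                             (λ _ _ → refl , refl) (λ _ → refl , refl) (λ _ → refl , refl)
      ; β-isIsomorphism = additiveIso L×L β γ-cong β-cong
          (λ (z , _) (z′ , _) → γ-+ z z′ , refl) γβ βγ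
      ; isotopy = λ (a , b) (c , d) → first a b c d , +-congʳ (*-congʳ (conj-conj a))
      }
      where
      first : ∀ a b c d → proj₁ (γ (Bq w (a ᵠ , b) (c , d))) ≈ proj₁ (B m diag (a , b) (c , d))
      first a b c d = begin
        (a ᵠ * c + b * d ᵠ + w * b ᵠ * d) ᵠ + m * (a ᵠ * c + b * d ᵠ + w * b ᵠ * d)
          ≈⟨ +-congʳ (ᵠ-+ (ᵠ-+ (ᵠ-* (conj-conj a) refl) (ᵠ-* refl (conj-conj d))) (ᵠ-* (ᵠ-* wᵠ≈ (conj-conj b)) refl)) ⟩
        (a * c ᵠ + b ᵠ * d + (μ ᵠ + x * x * τ μ) * b * d ᵠ) + m * (a ᵠ * c + b * d ᵠ + w * b ᵠ * d)
          ≈⟨ modulo w≈ (modulo [x²+x]τμ≈1 (modulo mx≈1+x (solve 13 (λ a b c d A B C D x m μ M w →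
               let t = μ :+ M ; h = (x :* x :+ x) :* t :+ con true in
               (a :* C :+ B :* d :+ (M :+ x :* x :* t) :* b :* D) :+ m :* (A :* c :+ b :* D :+ w :* B :* d)
               := con true :* a :* C :+ m :* con true :* A :* c :+ con false :* b :* C :+ m :* con false :* A :* d
                  :+ con false :* a :* D :+ m :* con false :* B :* c :+ μ :* b :* D :+ m :* μ :* B :* d
                  :+ m :* B :* d :* (w :+ (μ :+ x :* x :* t))
                  :+ (m :* b :* D :+ B :* d) :* h
                  :+ ((con true :+ x) :* t :* b :* D :+ x :* t :* B :* d) :* (m :* x :+ (con true :+ x)))
               ≡.refl a b c d (a ᵠ) (b ᵠ) (c ᵠ) (d ᵠ) x m μ (μ ᵠ) w))) ⟩
        proj₁ (B m diag (a , b) (c , d))  ∎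
        where
        wᵠ≈ : w ᵠ ≈ μ ᵠ + x * x * τ μ
        wᵠ≈ = trans (ᵠ-cong w≈) (ᵠ-+ refl (ᵠ-* (ᵠ-* xᵠ≈x xᵠ≈x) (τ-real μ)))

  -- From B(2, 2s, s, l, t) to B_q(w) and back

  B-to-Bq : ∀ l t → l ≉ 0# → ¬ IsPower[q-1] l → Legitimate t →
            ∃[ w ] (∃[ v ] τ w * v ≈ 1# × tr v ≈ 0#) × Isotopic L×L (B l t) (Bq w)
  B-to-Bq l (p₁ ∷ p₂ ∷ p₃ ∷ p₄ ∷ []) l≉0 l-not-power legitimate =
    w , (x * x + x , τw-inverse , tr≈0) ,
    Isotopic-trans L×L
      (diagonalise ζζ≈l ζ≉0 uu≉0 (orthogonal⇒det≉0 legitimate uu≉0 vv≉0 uv≈0) uv≈0 vu≈0 vv≈)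
      (DiagonalForm.B→Bq xᵠ≈x (norm-real ζ) mx≈1+x [x²+x]τμ≈1 refl)
    where
    open SesquilinearForm p₁ p₂ p₃ p₄

    ζ m : Carrier
    ζ = proj₁ (√ l)
    m = ζ * ζ ᵠ

    ζζ≈l : ζ * ζ ≈ l
    ζζ≈l = proj₂ (√ l)

    ζ≉0 : ζ ≉ 0#
    ζ≉0 ζ≈0 = l≉0 (trans (sym ζζ≈l) (trans (*-congˡ ζ≈0) (zeroʳ ζ)))

    -- The norm of l is m², so m = 1 would make l a (q-1)-th power.
    1+m≉0 : 1# + m ≉ 0#
    1+m≉0 1+m≈0 = l-not-power (norm-one⇒IsPower (begin
      l * l ᵠ                    ≈⟨ *-cong ζζ≈l (trans (sym (ᵠ-* refl refl)) (ᵠ-cong ζζ≈l)) ⟨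
      (ζ * ζ) * (ζ ᵠ * ζ ᵠ)      ≈⟨ modulo 1+m≈0 (solve 2 (λ z Z →
        (z :* z) :* (Z :* Z) := con true :+ (con true :+ z :* Z) :* (con true :+ z :* Z :+ con false)) ≡.refl ζ (ζ ᵠ)) ⟩
      1#                         ∎))

    x : Carrier
    x = proj₁ (inverse 1+m≉0)

    [1+m]x≈1 : (1# + m) * x ≈ 1#
    [1+m]x≈1 = proj₂ (inverse 1+m≉0)

    xᵠ≈x : x ᵠ ≈ x
    xᵠ≈x = inverse-real (ᵠ-+ 1ᵠ (norm-real ζ)) [1+m]x≈1

    mx≈1+x : m * x ≈ 1# + x
    mx≈1+x = modulo [1+m]x≈1 (solve 2 (λ m x →
      m :* x := con true :+ x :+ con true :* ((con true :+ m) :* x :+ con true)) ≡.refl m x)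

    x²+x≉0 : x * x + x ≉ 0#
    x²+x≉0 eq = *-≉0 x≉0 (*-≉0 (*-≉0 ζ≉0 (ᵠ-≉0 ζ≉0)) x≉0) (begin
      x * (m * x)   ≈⟨ *-congˡ mx≈1+x ⟩
      x * (1# + x)  ≈⟨ solve 1 (λ x → x :* (con true :+ x) := x :* x :+ x) ≡.refl x ⟩
      x * x + x     ≈⟨ eq ⟩
      0#            ∎)
      where
      x≉0 : x ≉ 0#
      x≉0 = inverse-≉0 [1+m]x≈1

    u v₀ : Carrier × Carrier
    u  = proj₁ (orthogonal-basis legitimate)
    v₀ = proj₁ (proj₂ (orthogonal-basis legitimate))

    uu≉0 : F u u ≉ 0#
    uu≉0 = proj₁ (proj₂ (proj₂ (orthogonal-basis legitimate)))

    v₀v₀≉0 : F v₀ v₀ ≉ 0#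
    v₀v₀≉0 = proj₁ (proj₂ (proj₂ (proj₂ (orthogonal-basis legitimate))))

    uv₀≈0 : F u v₀ ≈ 0#
    uv₀≈0 = proj₁ (proj₂ (proj₂ (proj₂ (proj₂ (orthogonal-basis legitimate)))))

    v₀u≈0 : F v₀ u ≈ 0#
    v₀u≈0 = proj₂ (proj₂ (proj₂ (proj₂ (proj₂ (orthogonal-basis legitimate)))))

    i μ₀ : Carrier
    i  = proj₁ (inverse uu≉0)
    μ₀ = F v₀ v₀ * i

    v₀v₀≈ : F v₀ v₀ ≈ F u u * μ₀
    v₀v₀≈ = modulo (proj₂ (inverse uu≉0)) (solve 3 (λ p r i →
      r := p :* (r :* i) :+ r :* (p :* i :+ con true)) ≡.refl (F u u) (F v₀ v₀) i)

    nonzero : (x * x + x) * τ μ₀ ≉ 0#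
    nonzero = *-≉0 x²+x≉0 (orthogonal⇒τ≉0 legitimate uu≉0 v₀v₀≉0 uv₀≈0 v₀u≈0 v₀v₀≈)

    -- Scaling `v₀` by ρ multiplies F(v₀, v₀), and with it μ₀, by ρ ρᵠ. This is k, because k and
    -- hence its square root ρ lie in K; k is the factor that makes (x² + x) τ(μ) equal to 1.
    k ρ : Carrier
    k = proj₁ (inverse nonzero)
    ρ = proj₁ (√ k)

    k-inverse : (x * x + x) * τ μ₀ * k ≈ 1#
    k-inverse = proj₂ (inverse nonzero)

    kᵠ≈k : k ᵠ ≈ k
    kᵠ≈k = inverse-real (ᵠ-* (ᵠ-+ (ᵠ-* xᵠ≈x xᵠ≈x) xᵠ≈x) (τ-real μ₀)) k-inverse

    ρρ≈k : ρ * ρ ≈ k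
    ρρ≈k = proj₂ (√ k)

    ρᵠ≈ρ : ρ ᵠ ≈ ρ
    ρᵠ≈ρ = √-real kᵠ≈k ρρ≈k

    v : Carrier × Carrier
    v = diagonal ρ ρ v₀

    μ w : Carrier
    μ = k * μ₀
    w = μ + x * x * τ μ

    τμ≈ : τ μ ≈ k * τ μ₀
    τμ≈ = trans (+-congˡ (ᵠ-* kᵠ≈k refl)) (sym (distribˡ k μ₀ (μ₀ ᵠ)))

    [x²+x]τμ≈1 : (x * x + x) * τ μ ≈ 1#
    [x²+x]τμ≈1 = trans (*-congˡ (trans τμ≈ (*-comm k _))) (trans (sym (*-assoc _ _ k)) k-inverse)

    vv≈kr : F v v ≈ k * F v₀ v₀
    vv≈kr = begin
      F v v                    ≈⟨ F-scaleˡ ρ v₀ v ⟩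
      ρ * F v₀ v               ≈⟨ *-congˡ (F-scaleʳ ρ v₀ v₀) ⟩
      ρ * (ρ ᵠ * F v₀ v₀)      ≈⟨ *-assoc ρ _ _ ⟨
      ρ * ρ ᵠ * F v₀ v₀        ≈⟨ *-congʳ (trans (*-congˡ ρᵠ≈ρ) ρρ≈k) ⟩
      k * F v₀ v₀              ∎

    vv≈ : F v v ≈ F u u * μ
    vv≈ = trans vv≈kr (trans (*-congˡ v₀v₀≈)
      (solve 3 (λ k p μ → k :* (p :* μ) := p :* (k :* μ)) ≡.refl k (F u u) μ₀))

    vv≉0 : F v v ≉ 0#
    vv≉0 vv≈0 = *-≉0 (inverse-≉0 k-inverse) v₀v₀≉0 (trans (sym vv≈kr) vv≈0)

    uv≈0 : F u v ≈ 0#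
    uv≈0 = trans (F-scaleʳ ρ u v₀) (trans (*-congˡ uv₀≈0) (zeroʳ _))

    vu≈0 : F v u ≈ 0#
    vu≈0 = trans (F-scaleˡ ρ v₀ u) (trans (*-congˡ v₀u≈0) (zeroʳ _))

    τw-inverse : τ w * (x * x + x) ≈ 1#
    τw-inverse = begin
      τ w * (x * x + x)                              ≈⟨ *-congʳ (τ-shift xᵠ≈x μ) ⟩
      τ μ * (x * x + x)                              ≈⟨ *-comm _ _ ⟩
      (x * x + x) * τ μ                              ≈⟨ [x²+x]τμ≈1 ⟩
      1#                                             ∎

    tr≈0 : tr (x * x + x) ≈ 0#
    tr≈0 = trans (Tr-x²+x s x) (≈⇒+≈0 xᵠ≈x)

  Bq-to-B : ∀ w → (∃[ v ] τ w * v ≈ 1# × tr v ≈ 0#) →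
            ∃[ l ] ∃[ t ] l ≉ 0# × ¬ IsPower[q-1] l × Legitimate t × Isotopic L×L (Bq w) (B l t)
  Bq-to-B w (v , τwv≈1 , tr≈0) =
    m , 1# ∷ 0# ∷ 0# ∷ μ ∷ [] , m≉0 , m-not-power , (1≉0 , no-zero) ,
    DiagonalForm.Bq→B xᵠ≈x mᵠ≈m mx≈1+x [x²+x]τμ≈1 w≈
    where
    v-real : v ᵠ ≈ v
    v-real = inverse-real (τ-real w) τwv≈1

    x : Carrier
    x = proj₁ (artin-schreier v v-real)

    x²+x≈v : x * x + x ≈ v
    x²+x≈v = proj₂ (artin-schreier v v-real)

    -- A priori x lies only in L; the trace of v = x² + x is xᵠ + x, so the trace condition is what
    -- puts x into K.
    xᵠ≈x : x ᵠ ≈ x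
    xᵠ≈x = +≈0⇒≈ (trans (sym (Tr-x²+x s x)) (trans (Tr-cong s x²+x≈v) tr≈0))

    x[1+x]≉0 : x * (1# + x) ≉ 0#
    x[1+x]≉0 eq = inverse-≉0 τwv≈1 (begin
      v             ≈⟨ x²+x≈v ⟨
      x * x + x     ≈⟨ solve 1 (λ x → x :* x :+ x := x :* (con true :+ x)) ≡.refl x ⟩
      x * (1# + x)  ≈⟨ eq ⟩
      0#            ∎)

    x≉0 : x ≉ 0#
    x≉0 x≈0 = x[1+x]≉0 (trans (*-congʳ x≈0) (zeroˡ _))

    i m μ : Carrier
    i = proj₁ (inverse x≉0)
    m = (1# + x) * i
    -- The map y ↦ y + x² τ(y) preserves τ and is therefore its own inverse.
    μ = w + x * x * τ w

    xi≈1 : x * i ≈ 1#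
    xi≈1 = proj₂ (inverse x≉0)

    mx≈1+x : m * x ≈ 1# + x
    mx≈1+x = modulo xi≈1 (solve 2 (λ x i → (con true :+ x) :* i :* x
      := con true :+ x :+ (con true :+ x) :* (x :* i :+ con true)) ≡.refl x i)

    mᵠ≈m : m ᵠ ≈ m
    mᵠ≈m = ᵠ-* (ᵠ-+ 1ᵠ xᵠ≈x) (inverse-real xᵠ≈x xi≈1)

    m≉0 : m ≉ 0#
    m≉0 m≈0 = x[1+x]≉0 (trans (*-congˡ (trans (sym mx≈1+x) (trans (*-congʳ m≈0) (zeroˡ x)))) (zeroʳ x))

    -- The norm of m ∈ K is m². If it were 1, then m = 1, against m x = 1 + x.
    m-not-power : ¬ IsPower[q-1] m
    m-not-power m-power = 1≉0 (modulo mx≈1+x (modulo mm≈1 (solve 2 (λ m x →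
      con true := con false :+ (m :* x :+ con true :+ x) :* (m :* x :+ (con true :+ x))
                  :+ x :* x :* (m :* m :+ con true)) ≡.refl m x)))
      where
      mm≈1 : m * m ≈ 1#
      mm≈1 = trans (*-congˡ (sym mᵠ≈m)) (IsPower⇒norm-one m-power)

    τμ≈τw : τ μ ≈ τ w
    τμ≈τw = τ-shift xᵠ≈x w

    [x²+x]τμ≈1 : (x * x + x) * τ μ ≈ 1#
    [x²+x]τμ≈1 = trans (*-cong x²+x≈v τμ≈τw) (trans (*-comm v _) τwv≈1)

    w≈ : w ≈ μ + x * x * τ μ
    w≈ = modulo τμ≈τw (solve 4 (λ w x a b →
      w := w :+ x :* x :* b :+ x :* x :* a :+ x :* x :* (a :+ b)) ≡.refl w x (τ μ) (τ w))

    -- A root would make μ a norm, hence an element of K, so that τ(μ) = 0.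
    no-zero : ∀ y → 1# * y ^ (q ℕ.+ 1) + 0# * y ᵠ + 0# * y + μ ≉ 0#
    no-zero y eq = 1≉0 (begin
      1#                   ≈⟨ [x²+x]τμ≈1 ⟨
      (x * x + x) * τ μ    ≈⟨ *-congˡ (≈⇒+≈0 (trans (sym N≈μ) (trans (sym (norm-real y)) (ᵠ-cong N≈μ)))) ⟩
      (x * x + x) * 0#     ≈⟨ zeroʳ _ ⟩
      0#                   ∎)
      where
      N≈μ : y * y ᵠ ≈ μ
      N≈μ = modulo (trans (+-congʳ (+-congʳ (+-congʳ (*-congˡ (sym (^-homo-* y q 1)))))) eq)
        (solve 3 (λ y Y μ → y :* Y := μ :+ con true :*
          (con true :* (Y :* (y :* con true)) :+ con false :* Y :+ con false :* y :+ μ :+ con false))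
          ≡.refl y (y ᵠ) μ)

open import Data.Nat.Base using (_≤_; _^_)

corollary4 : ∀ {c ℓ k} (s : ℕ) → 1 ≤ s →
    (L : CommutativeRing c ℓ) → IsField L →
    (let open CommutativeRing L) →
    HasOrder setoid ((2 ^ s) ^ 2) →
    (K : Pred Carrier k) → IsSubfield L K →
    HasOrder (subsetSetoid setoid K) (2 ^ s) →
    (let open Presemifields s L) →
    (∀ l t → l ≉ 0# → ¬ IsPower[q-1] l → Legitimate t →
    ∃[ w ] Admissible K w × Isotopic L×L (B l t) (Bq w))
    ×
    (∀ w → Admissible K w →
    ∃[ l ] ∃[ t ] l ≉ 0# × ¬ IsPower[q-1] l × Legitimate t ×
    Isotopic L×L (Bq w) (B l t))
corollary4 s 1≤s L isField orderL K isSubfield orderK =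
  (λ l t l≉0 l-not-power legitimate →
    let w , admissible@(v , τwv≈1 , _) , isotopic = B-to-Bq l t l≉0 l-not-power legitimate
    in w , ((λ w∈K → τ∈K≉0 w∈K τwv≈1) , admissible) , isotopic) ,
  (λ w (_ , admissible) → Bq-to-B w admissible)
  where
  open Isotopies s 1≤s L isField orderL using (B-to-Bq; Bq-to-B)
  open Conjugation s 1≤s L isField orderL
  -- By Fermat's theorem in K, of order q, w = wᵠ; so τ(w) = w + w = 0 has no inverse.
  τ∈K≉0 : ∀ {w v} → w ∈ K → ¬ τ w * v ≈ 1#
  τ∈K≉0 {w} {v} w∈K τwv≈1 = inverse-≉0 (trans (*-comm v (τ w)) τwv≈1)
    (≈⇒+≈0 (sym (FieldProperties.fermat L isField isSubfield orderK w∈K)))
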